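{- For every integer $n\ge 1$, $$m_{1,4}^o(n) = \begin{cases} m_{3,4}^e(n) & \text{if $n$ is odd,} \\ m_{3,4}^e(n) + q^o(n/2) & \text{if $n$ is even,} \end{cases}$$ and $$m_{1,4}^e(n) = \begin{cases} m_{3,4}^o(n) & \text{if $n$ is odd,} \\ m_{3,4}^o(n) + q^e(n/2) & \text{if $n$ is even.} \end{cases}$$
   Context: A partition of a positive integer $n$ is a finite weakly decreasing sequence of positive integers with sum $n$; its length is its number of parts. The mex of a partition is the smallest positive integer that is not one of its parts. For $a\in\{1,3\}$, $m_{a,4}^o(n)$ (respectively $m_{a,4}^e(n)$) is the number of partitions of $n$ whose mex is congruent to $a$ modulo $4$ and whose length is odd (respectively even). $q^o(n)$ (respectively $q^e(n)$) is the number of partitions of $n$ into distinct parts with an odd (respectively even) number of parts. -}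

module Defs where

open import Data.List using (List; []; _∷_; length; map; filter; upTo; cartesianProductWith)
open import Data.List.Properties using (∷-injective)
open import Data.List.Membership.Propositional using (_∈_; _∉_)
open import Data.List.Membership.Propositional.Properties
  using (∈-filter⁺; ∈-filter⁻; ∈-map⁺; ∈-upTo⁺; ∈-cartesianProductWith⁺; ∈-cartesianProductWith⁻)
open import Data.List.Relation.Unary.All using (All; []; _∷_; all?)
open import Data.List.Relation.Unary.All.Properties using (¬Any⇒All¬)
open import Data.List.Relation.Unary.AllPairs using ([]; _∷_)
open import Data.List.Relation.Unary.Any using (here; there)
open import Data.List.Relation.Unary.Linked using (Linked; linked?)
open import Data.List.Relation.Unary.Unique.Propositional using (Unique)
open import Data.List.Relation.Unary.Unique.Propositional.Properties
  using (filter⁺; map⁺; upTo⁺; cartesianProductWith⁺)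
open import Data.Nat using (ℕ; zero; suc; _+_; _≤_; _<_; _≥_; z≤n; s≤s; _≤?_; _≥?_; _≟_; _%_; NonZero)
open import Data.Nat.Divisibility using (_∣_; _∤_; _∣?_)
open import Data.Nat.ListAction using (sum)
open import Data.Nat.Properties
  using (≤-refl; ≤-trans; m≤m+n; m≤n+m; +-mono-≤; +-suc; +-identityʳ; suc-injective; <⇒≱; m<1+n⇒m<n∨m≡n)
open import Data.List.Membership.DecPropositional _≟_ using (_∈?_)
open import Data.List.Relation.Unary.Unique.DecPropositional _≟_ using (unique?)
open import Data.Product using (_×_; _,_; proj₂)
open import Data.Sum using (inj₁; inj₂)
open import Function.Bundles using (_⇔_; mk⇔)
open import Relation.Binary.PropositionalEquality using (_≡_; refl; sym; subst)
open import Relation.Nullary using (yes; no; contradiction)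
open import Relation.Nullary.Decidable using (map′; _×-dec_; ¬?)
open import Relation.Unary using (Pred; Decidable)
open import Level using (0ℓ)

record IsPartition (n : ℕ) (xs : List ℕ) : Set where
  constructor isPartition
  field
    positive   : All (1 ≤_) xs
    decreasing : Linked _≥_ xs
    total      : sum xs ≡ n

isPartition? : ∀ n → Decidable (IsPartition n)
isPartition? n xs = map′
  (λ (p , d , t) → isPartition p d t)
  (λ (isPartition p d t) → p , d , t)
  (all? (1 ≤?_) xs ×-dec linked? _≥?_ xs ×-dec (sum xs ≟ n))

listsUpTo : ℕ → List ℕ → List (List ℕ)
listsUpTo zero    as = [] ∷ []
listsUpTo (suc ℓ) as = [] ∷ cartesianProductWith _∷_ as (listsUpTo ℓ as)

-- A partition of n has at most n parts, each between 1 and n, so searching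
-- these lists misses none; ∈-partitions and partitions-unique below confirm
-- that every partition is listed exactly once.
partitions : ℕ → List (List ℕ)
partitions n = filter (isPartition? n) (listsUpTo n (map suc (upTo n)))

listsUpTo-unique : ∀ ℓ {as} → Unique as → Unique (listsUpTo ℓ as)
listsUpTo-unique zero         u = [] ∷ []
listsUpTo-unique (suc ℓ) {as} u =
  ¬Any⇒All¬ _ []∉ ∷ cartesianProductWith⁺ _∷_ ∷-injective u (listsUpTo-unique ℓ u)
  where
  []∉ : [] ∉ cartesianProductWith _∷_ as (listsUpTo ℓ as)
  []∉ []∈ with ∈-cartesianProductWith⁻ _∷_ as (listsUpTo ℓ as) []∈
  ... | _ , _ , _ , _ , ()

∈-listsUpTo : ∀ {ℓ as xs} → length xs ≤ ℓ → All (_∈ as) xs → xs ∈ listsUpTo ℓ as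
∈-listsUpTo {zero}  {xs = []} _       _        = here refl
∈-listsUpTo {suc ℓ} {xs = []} _       _        = here refl
∈-listsUpTo {suc ℓ}           (s≤s l) (x ∷ xs) =
  there (∈-cartesianProductWith⁺ _∷_ x (∈-listsUpTo l xs))

length≤sum : ∀ {xs} → All (1 ≤_) xs → length xs ≤ sum xs
length≤sum []       = z≤n
length≤sum (p ∷ ps) = +-mono-≤ p (length≤sum ps)

∈⇒≤sum : ∀ {x xs} → x ∈ xs → x ≤ sum xs
∈⇒≤sum {xs = y ∷ ys} (here refl) = m≤m+n y (sum ys)
∈⇒≤sum {xs = y ∷ ys} (there i)   = ≤-trans (∈⇒≤sum i) (m≤n+m (sum ys) y)

partitions-unique : ∀ n → Unique (partitions n)
partitions-unique n =
  filter⁺ (isPartition? n) (listsUpTo-unique n (map⁺ suc-injective (upTo⁺ n)))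

∈-partitions : ∀ {n xs} → xs ∈ partitions n ⇔ IsPartition n xs
∈-partitions {n} {xs} = mk⇔
  (λ i → proj₂ (∈-filter⁻ (isPartition? n) {xs = listsUpTo n (map suc (upTo n))} i))
  (λ p → ∈-filter⁺ (isPartition? n) (candidate p) p)
  where
  entry : ∀ {x} → 1 ≤ x → x ≤ n → x ∈ map suc (upTo n)
  entry {suc x} _ x<n = ∈-map⁺ suc (∈-upTo⁺ x<n)

  entries : ∀ {ys} → All (1 ≤_) ys → sum ys ≤ n → All (_∈ map suc (upTo n)) ys
  entries []                _ = []
  entries {y ∷ ys} (p ∷ ps) s =
    entry p (≤-trans (m≤m+n y (sum ys)) s) ∷ entries ps (≤-trans (m≤n+m (sum ys) y) s)

  candidate : IsPartition n xs → xs ∈ listsUpTo n (map suc (upTo n))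
  candidate (isPartition p _ refl) = ∈-listsUpTo (length≤sum p) (entries p ≤-refl)

-- The least k in { c , c + 1 , … , c + f } that is not in xs, with c + f
-- returned when all the earlier ones are in xs.
mexFrom : List ℕ → ℕ → ℕ → ℕ
mexFrom xs c zero    = c
mexFrom xs c (suc f) with c ∈? xs
... | yes _ = mexFrom xs (suc c) f
... | no  _ = c

-- No part exceeds the sum, so the search from 1 succeeds by 1 + sum xs.
mex : List ℕ → ℕ
mex xs = mexFrom xs 1 (sum xs)

record IsMex (xs : List ℕ) (m : ℕ) : Set where
  constructor isMex
  field
    positive : 1 ≤ m
    missing  : m ∉ xs
    least    : ∀ k → 1 ≤ k → k < m → k ∈ xs

mexFrom-isMex : ∀ xs c f → 1 ≤ c → (∀ k → 1 ≤ k → k < c → k ∈ xs) →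
                c + f ∉ xs → IsMex xs (mexFrom xs c f)
mexFrom-isMex xs c zero    1≤c below end =
  isMex 1≤c (λ c∈ → end (subst (_∈ xs) (sym (+-identityʳ c)) c∈)) below
mexFrom-isMex xs c (suc f) 1≤c below end with c ∈? xs
... | no  c∉ = isMex 1≤c c∉ below
... | yes c∈ = mexFrom-isMex xs (suc c) f (s≤s z≤n) below′
                 (subst (_∉ xs) (+-suc c f) end)
  where
  below′ : ∀ k → 1 ≤ k → k < suc c → k ∈ xs
  below′ k 1≤k k<1+c with m<1+n⇒m<n∨m≡n k<1+c
  ... | inj₁ k<c  = below k 1≤k k<c
  ... | inj₂ refl = c∈

mex-isMex : ∀ xs → IsMex xs (mex xs)
mex-isMex xs = mexFrom-isMex xs 1 (sum xs) ≤-refl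
  (λ k 1≤k k<1 → contradiction 1≤k (<⇒≱ k<1))
  (λ i → <⇒≱ ≤-refl (∈⇒≤sum i))

Even Odd : ℕ → Set
Even n = 2 ∣ n
Odd  n = 2 ∤ n

even? : Decidable Even
even? n = 2 ∣? n

odd? : Decidable Odd
odd? n = ¬? (even? n)

countPartitions : {P : Pred (List ℕ) 0ℓ} → Decidable P → ℕ → ℕ
countPartitions P? n = length (filter P? (partitions n))

MexCong : (a k : ℕ) .{{_ : NonZero k}} → List ℕ → Set
MexCong a k xs = mex xs % k ≡ a % k

mexCong? : ∀ a k .{{_ : NonZero k}} → Decidable (MexCong a k)
mexCong? a k xs = mex xs % k ≟ a % k

mᵒ mᵉ : (a k : ℕ) .{{_ : NonZero k}} → ℕ → ℕ
mᵒ a k = countPartitions (λ xs → mexCong? a k xs ×-dec odd?  (length xs))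
mᵉ a k = countPartitions (λ xs → mexCong? a k xs ×-dec even? (length xs))

qᵒ qᵉ : ℕ → ℕ
qᵒ = countPartitions (λ xs → unique? xs ×-dec odd?  (length xs))
qᵉ = countPartitions (λ xs → unique? xs ×-dec even? (length xs))

{-# OPTIONS --safe #-}
-- Give a partition of length ℓ the weight z^ℓ with z² = 1, and let c(m) be 1, -z or 0
-- according as m is 1, 3 or even modulo 4. Partitions of mex > k correspond, by removing
-- 1, …, k, to arbitrary partitions of n - k(k+1)/2, so telescoping c gives
--   Σ_λ z^ℓ(λ) c(mex λ) q^|λ| = Σ_k r^(k(k+1)/2) / Π (1 - z q^i),   r = -z q.
-- By Gauss's identity the right side is Π (1 + z q^(2i)), the generating function of
-- partitions into distinct parts, doubled. The values z = 1 and z = -1 separate even and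
-- odd lengths. Gauss's identity is replaced by Shanks' finite version, so that only parts
-- ≤ 2n are used and the error is a multiple of q^(2n+1).
module Submission where

open import Defs
open import Algebra.Bundles using (CommutativeRing)
import Algebra.Construct.Pointwise as Pointwise
import Algebra.Solver.Ring
open import Algebra.Solver.Ring.AlmostCommutativeRing
  using (fromCommutativeRing; _-Raw-AlmostCommutative⟶_; Induced-equivalence)
open import Data.Integer as ℤ using (ℤ; 0ℤ; 1ℤ; -1ℤ)
import Data.Integer.Properties as ℤ
open import Data.Integer.Tactic.RingSolver using (solve-∀)
open import Data.List using (List; []; _∷_; _++_; map; filter; length)
open import Data.List.Properties using (∷-injectiveʳ; filter-all)
open import Data.List.Membership.Propositional using (_∈_; _∉_)
open import Data.List.Membership.Propositional.Properties
  using (∈-filter⁺; ∈-filter⁻; ∈-++⁺ˡ; ∈-++⁺ʳ; ∈-++⁻; ∈-map⁺; ∈-map⁻)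
open import Data.List.Membership.Propositional.Properties.WithK using (unique∧set⇒bag)
open import Data.List.Relation.Binary.BagAndSetEquality using (∼bag⇒↭)
open import Data.List.Relation.Binary.Permutation.Propositional as ↭ using (_↭_)
open import Data.List.Relation.Unary.All as All using (All; []; _∷_; all?)
open import Data.List.Relation.Unary.AllPairs using ([]; _∷_)
open import Data.List.Relation.Unary.Any using (here; there)
open import Data.List.Relation.Unary.Linked using (Linked; []; [-]; _∷_)
open import Data.List.Relation.Unary.Linked.Properties using (Linked⇒All)
open import Data.List.Relation.Unary.Unique.Propositional using (Unique)
import Data.List.Relation.Unary.Unique.Propositional.Properties as Unique
import Data.Maybe as Maybe
open import Data.Nat as ℕ using (ℕ; zero; suc; _≤_; _<_; _≥_; s≤s; z≤n; _%_; _/_)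
open import Data.Nat.Divisibility using (_∣_; divides; ∣m+n∣m⇒∣n; ∣m∣n⇒∣m+n; ∣-refl)
open import Data.Nat.DivMod using (m*n/n≡m)
import Data.Nat.ListAction as ℕ
import Data.Nat.Properties as ℕ
open import Data.List.Relation.Unary.Unique.DecPropositional ℕ._≟_ using (unique?)
open import Data.Product using (_×_; _,_; proj₁; proj₂; ∃)
open import Data.Sum as Sum using (_⊎_; inj₁; inj₂)
open import Function using (_∘_; flip)
open import Function.Bundles using (Equivalence; mk⇔)
open import Level using (0ℓ)
open import Relation.Binary.Definitions using (WeaklyDecidable; tri<; tri≈; tri>)
import Relation.Binary.PropositionalEquality as ≡
open import Relation.Nullary using (Dec; yes; no; ¬_; contradiction)
open import Relation.Nullary.Decidable using (_×-dec_; ¬?; dec⇒maybe)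
open import Relation.Unary using (Pred; Decidable)

-- The shape of c comes from the telescoping. Partitions with parts at most k that include all of 1,
-- ..., k have a series with numerator z^k q^(k(k+1)/2), and the jump c(k+1) - c(k) must turn every
-- such numerator into a power of one variable: (c(k+1) - c(k)) z^k = (-z)^(k(k+1)/2), starting from
-- c(0) = 0. This gives -z at 3 modulo 4, and the same -z exchanges the parities of length between
-- the two mex classes. The product side closes up because z² = 1: the factors 1 - r^(2i-1) = 1 + z
-- q^(2i-1) interlace with the factors 1 + z q^(2i), and each 1 + z q^i then meets a 1 - z q^i from
-- the partition denominator. No series is ever inverted. Both sides are multiplied by the
-- denominators, whose product has constant term 1 and is cancelled coefficient by coefficient at
-- the end. Everything before that cancellation is algebra over a commutative ring with z² = 1.

module Shanks {c ℓ} (R : CommutativeRing c ℓ)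
  (int : ℤ.+-*-rawRing -Raw-AlmostCommutative⟶ fromCommutativeRing R)
  where

  open CommutativeRing R
  open import Relation.Binary.Reasoning.Setoid setoid
  open import Algebra.Properties.CommutativeSemiring.Exp commutativeSemiring
    using (_^_; ^-distrib-*; ^-congˡ)

  private
    int≟ : WeaklyDecidable (Induced-equivalence int)
    int≟ k l = Maybe.map (λ k≡l → reflexive (≡.cong (_-Raw-AlmostCommutative⟶_.⟦_⟧ int) k≡l))
      (dec⇒maybe (k ℤ.≟ l))

  open Algebra.Solver.Ring ℤ.+-*-rawRing (fromCommutativeRing R) int int≟
    using (solve; _:=_; _:+_; _:*_; _:-_; :-_; _:^_)

  -- A, B and S are the partial products and sums of Gauss's identity
  -- Π (1 - r^(2i)) = Π (1 - r^(2i-1)) · Σ r^(k(k+1)/2), with x n = r^(2n+1);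
  -- L m y = Σ_{s ≤ m} (A m / A s) B s y^s, without the division.
  module Products (r : Carrier) where
    x : ℕ → Carrier
    x n = r * (r * r) ^ n

    A B S : ℕ → Carrier
    A zero    = 1#
    A (suc n) = A n * (1# - r * x n)
    B zero    = 1#
    B (suc n) = B n * (1# - x n)
    S zero    = 1#
    S (suc n) = S n + x n ^ suc n + x (suc n) ^ suc n

    L : ℕ → Carrier → Carrier
    L zero    y = 1#
    L (suc m) y = (1# - r * x m) * L m y + B (suc m) * y ^ suc m

    L-cong : ∀ m {y y′} → y ≈ y′ → L m y ≈ L m y′
    L-cong zero    y≈y′ = refl
    L-cong (suc m) y≈y′ = +-cong (*-congˡ (L-cong m y≈y′)) (*-congˡ (^-congˡ (suc m) y≈y′))

    x-suc : ∀ n → x (suc n) ≈ x n * (r * r)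
    x-suc n = solve 2 (λ r p → r :* (r :* r :* p) := r :* p :* (r :* r)) refl r ((r * r) ^ n)

    -- A truncated q-difference equation. With t_s = B s y^s / A s, replacing y by y r² multiplies
    -- t_s by r^(2s), and (1 - r^(2s)) t_s = y (1 - r^(2s-1)) t_(s-1); summing over s ≤ m leaves one
    -- boundary term. At y = x m the factor 1 - r y is the one in the recursion of `L`.
    L-shift : ∀ m y → (1# - r * y) * L m (y * (r * r)) ≈ (1# - y) * L m y + B (suc m) * y ^ suc m
    L-shift zero y =
      -- `r :^ 0` denotes `1#` itself, whereas an integer coefficient would denote its image under
      -- `int`, which is only equivalent to it.
      solve 2 (λ r y → let one = r :^ 0 in
        (one :- r :* y) :* one := (one :- y) :* one :+ one :* (one :- r :* one) :* (y :* one)) refl r y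
    L-shift (suc m) y = begin
      (1# - r * y) * ((1# - r * x m) * L m y′ + B (suc m) * y′ ^ suc m)
        ≈⟨ *-congˡ (+-congˡ (*-congˡ (^-distrib-* y (r * r) (suc m)))) ⟩
      (1# - r * y) * ((1# - r * x m) * L m y′ + B (suc m) * (y ^ suc m * (r * r * p)))
        ≈⟨ solve 6 (λ r y p l b w → let one = r :^ 0 in
             (one :- r :* y) :* ((one :- r :* (r :* p)) :* l :+ b :* (w :* (r :* r :* p))) :=
             (one :- r :* (r :* p)) :* ((one :- r :* y) :* l)
               :+ (one :- r :* y) :* (b :* (w :* (r :* r :* p))))
           refl r y p (L m y′) (B (suc m)) (y ^ suc m) ⟩
      (1# - r * x m) * ((1# - r * y) * L m y′) + (1# - r * y) * (B (suc m) * (y ^ suc m * (r * r * p)))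
        ≈⟨ +-congʳ (*-congˡ (L-shift m y)) ⟩
      (1# - r * x m) * ((1# - y) * L m y + B (suc m) * y ^ suc m)
        + (1# - r * y) * (B (suc m) * (y ^ suc m * (r * r * p)))
        ≈⟨ solve 6 (λ r y p l b w → let one = r :^ 0 in
             (one :- r :* (r :* p)) :* ((one :- y) :* l :+ b :* w)
               :+ (one :- r :* y) :* (b :* (w :* (r :* r :* p))) :=
             (one :- y) :* ((one :- r :* (r :* p)) :* l :+ b :* w)
               :+ b :* (one :- r :* (r :* r :* p)) :* (y :* w))
           refl r y p (L m y) (B (suc m)) (y ^ suc m) ⟩
      (1# - y) * L (suc m) y + B (suc (suc m)) * y ^ suc (suc m) ∎
      where
      y′ = y * (r * r)
      p  = (r * r) ^ m

    -- Shanks' finite form of Gauss's identity; its limit arises because L n y ≡ A n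
    -- modulo y, where y = x n has high order.
    B*S≈L : ∀ n → B n * S n ≈ L n (x n)
    B*S≈L zero    = *-identityˡ 1#
    B*S≈L (suc n) = begin
      B n * (1# - x n) * (S n + x n ^ suc n + x (suc n) ^ suc n)
        ≈⟨ solve 6 (λ r b y s u v → let one = r :^ 0 in
             b :* (one :- y) :* (s :+ u :+ v) :=
             (one :- y) :* (b :* s) :+ b :* (one :- y) :* u :+ b :* (one :- y) :* v)
           refl r (B n) (x n) (S n) (x n ^ suc n) (x (suc n) ^ suc n) ⟩
      (1# - x n) * (B n * S n) + B (suc n) * x n ^ suc n + B (suc n) * x (suc n) ^ suc n
        ≈⟨ +-congʳ (+-congʳ (*-congˡ (B*S≈L n))) ⟩
      (1# - x n) * L n (x n) + B (suc n) * x n ^ suc n + B (suc n) * x (suc n) ^ suc n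
        ≈⟨ +-congʳ (L-shift n (x n)) ⟨
      (1# - r * x n) * L n (x n * (r * r)) + B (suc n) * x (suc n) ^ suc n
        ≈⟨ +-congʳ (*-congˡ (L-cong n (x-suc n))) ⟨
      L (suc n) (x (suc n)) ∎

    -- Only the term s = 0 is free of y. Divisibility is expressed by an explicit cofactor, since a
    -- general ring has no order of vanishing.
    L-mod : ∀ m y → ∃ λ t → L m y ≈ A m + y * t
    L-mod zero    y = 0# , sym (trans (+-congˡ (zeroʳ y)) (+-identityʳ 1#))
    L-mod (suc m) y with L-mod m y
    ... | t , L≈ = (1# - r * x m) * t + B (suc m) * y ^ m , (begin
      (1# - r * x m) * L m y + B (suc m) * (y * y ^ m)
        ≈⟨ +-congʳ (*-congˡ L≈) ⟩
      (1# - r * x m) * (A m + y * t) + B (suc m) * (y * y ^ m)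
        ≈⟨ solve 6 (λ a y t b w c →
             c :* (a :+ y :* t) :+ b :* (y :* w) := a :* c :+ y :* (c :* t :+ b :* w))
           refl (A m) y t (B (suc m)) (y ^ m) (1# - r * x m) ⟩
      A (suc m) + y * ((1# - r * x m) * t + B (suc m) * y ^ m) ∎)

    x-+ : ∀ j n → x (j ℕ.+ n) ≈ x n * (r * r) ^ j
    x-+ zero    n = sym (*-identityʳ (x n))
    x-+ (suc j) n = begin
      x (suc (j ℕ.+ n))           ≈⟨ x-suc (j ℕ.+ n) ⟩
      x (j ℕ.+ n) * (r * r)       ≈⟨ *-congʳ (x-+ j n) ⟩
      x n * (r * r) ^ j * (r * r) ≈⟨ *-assoc _ _ _ ⟩
      x n * ((r * r) ^ j * (r * r)) ≈⟨ *-congˡ (*-comm _ _) ⟩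
      x n * (r * r) ^ suc j       ∎

    -- Every further factor differs from 1 by a multiple of x n. This bridges `A n`, which `L-mod`
    -- produces, and `A (n * 2)`, which the product side produces.
    A-mod : ∀ j n → ∃ λ t → A (j ℕ.+ n) ≈ A n + x n * t
    A-mod zero    n = 0# , sym (trans (+-congˡ (zeroʳ (x n))) (+-identityʳ (A n)))
    A-mod (suc j) n with A-mod j n
    ... | t , A≈ = t * (1# - r * x (j ℕ.+ n)) - A n * r * (r * r) ^ j , (begin
      A (j ℕ.+ n) * (1# - r * x (j ℕ.+ n))
        ≈⟨ *-congʳ A≈ ⟩
      (A n + x n * t) * (1# - r * x (j ℕ.+ n))
        ≈⟨ solve 5 (λ a y t r w → let one = r :^ 0 in
             (a :+ y :* t) :* (one :- r :* w) := a :+ y :* (t :* (one :- r :* w)) :- a :* r :* w)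
           refl (A n) (x n) t r (x (j ℕ.+ n)) ⟩
      A n + x n * (t * (1# - r * x (j ℕ.+ n))) - A n * r * x (j ℕ.+ n)
        ≈⟨ +-congˡ (-‿cong (*-congˡ (x-+ j n))) ⟩
      A n + x n * (t * (1# - r * x (j ℕ.+ n))) - A n * r * (x n * (r * r) ^ j)
        ≈⟨ solve 5 (λ a y c r w → a :+ y :* c :- a :* r :* (y :* w) := a :+ y :* (c :- a :* r :* w))
           refl (A n) (x n) (t * (1# - r * x (j ℕ.+ n))) r ((r * r) ^ j) ⟩
      A n + x n * (t * (1# - r * x (j ℕ.+ n)) - A n * r * (r * r) ^ j) ∎)

  -- The mex series with denominators cleared

  ^-double : ∀ w n → w ^ (n ℕ.* 2) ≈ (w * w) ^ n
  ^-double w zero    = refl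
  ^-double w (suc n) = trans (sym (*-assoc w w _)) (*-congˡ (^-double w n))

  -- In the intended reading q is the indeterminate, M k and F k enumerate the
  -- partitions into parts ≤ k (F k only those containing 1, …, k), and P n is
  -- Π_{i ≤ n} (1 + z q^(2i)).
  module MexSeries
    (q z : Carrier) (z²≈1 : z * z ≈ 1#)
    (d M F P : ℕ → Carrier)
    (d₀ : d 0 ≈ 1#) (d₁ : d 1 ≈ - 1#) (d-step : ∀ k → d (suc (suc k)) ≈ - (z * d k))
    (M₀ : M 0 ≈ 1#) (F₀ : F 0 ≈ 1#) (P₀ : P 0 ≈ 1#)
    (F-step : ∀ k → F (suc k) ≈ q ^ suc k * (z * (F (suc k) + F k)))
    (M-step : ∀ k → M (suc k) ≈ M k + q ^ suc k * (z * (M (suc k) + d (suc k) * F k)))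
    (P-step : ∀ k → P (suc k) ≈ P k + q ^ (suc k ℕ.* 2) * (z * P k))
    where

    r : Carrier
    r = - (z * q)

    open Products r

    -- The denominator of the series of all partitions into parts ≤ k, weighted by z to the length.
    -- `F-step` and `M-step` have the unknown on both sides; multiplying by `V` solves them.
    V : ℕ → Carrier
    V zero    = 1#
    V (suc k) = V k * (1# - z * q ^ suc k)

    private
      p : ℕ → Carrier
      p n = (r * r) ^ n

      r²≈q² : r * r ≈ q * q
      r²≈q² = begin
        r * r             ≈⟨ solve 2 (λ z q → :- (z :* q) :* :- (z :* q) := (z :* z) :* (q :* q)) refl z q ⟩
        z * z * (q * q)   ≈⟨ *-congʳ z²≈1 ⟩
        1# * (q * q)      ≈⟨ *-identityˡ (q * q) ⟩
        q * q             ∎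

      q^[n*2]≈p : ∀ n → q ^ (n ℕ.* 2) ≈ p n
      q^[n*2]≈p n = trans (^-double q n) (^-congˡ n (sym r²≈q²))

      x≈ : ∀ n → x n ≈ - (z * q ^ suc (n ℕ.* 2))
      x≈ n = begin
        - (z * q) * p n ≈⟨ solve 3 (λ z q w → :- (z :* q) :* w := :- (z :* (q :* w))) refl z q (p n) ⟩
        - (z * (q * p n)) ≈⟨ -‿cong (*-congˡ (*-congˡ (q^[n*2]≈p n))) ⟨
        - (z * q ^ suc (n ℕ.* 2)) ∎

      rx≈ : ∀ n → r * x n ≈ q ^ suc (suc (n ℕ.* 2))
      rx≈ n = begin
        r * (r * p n)               ≈⟨ *-assoc r r (p n) ⟨
        r * r * p n                 ≈⟨ *-cong r²≈q² (sym (q^[n*2]≈p n)) ⟩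
        q * q * q ^ (n ℕ.* 2)       ≈⟨ *-assoc q q _ ⟩
        q ^ suc (suc (n ℕ.* 2))     ∎

    -- Collecting the terms in `F (suc k)` of `F-step` produces exactly the new factor of `V`.
    VF-step : ∀ k → V (suc k) * F (suc k) ≈ z * q ^ suc k * (V k * F k)
    VF-step k = begin
      V k * (1# - z * Q) * f′
        ≈⟨ solve 4 (λ v z q f →
             let one = z :^ 0 in v :* (one :- z :* q) :* f :=
             v :* (f :- z :* q :* f))
           refl (V k) z Q f′ ⟩
      V k * (f′ - z * Q * f′)
        ≈⟨ *-congˡ (+-congʳ (F-step k)) ⟩
      V k * (Q * (z * (f′ + F k)) - z * Q * f′)
        ≈⟨ solve 5 (λ v z q f g →
             v :* (q :* (z :* (f :+ g)) :- z :* q :* f) :=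
             z :* q :* (v :* g))
           refl (V k) z Q f′ (F k) ⟩
      z * Q * (V k * F k) ∎
      where
      Q  = q ^ suc k
      f′ = F (suc k)

    -- The telescoping step: iterated, it writes V k M k as the sum of d j V j F j over j ≤ k, so
    -- that only the jumps of the mex weight remain.
    VM-step : ∀ k → V (suc k) * M (suc k) ≈ V k * M k + d (suc k) * (V (suc k) * F (suc k))
    VM-step k = begin
      V k * (1# - z * Q) * m′
        ≈⟨ solve 4 (λ v z q f →
             let one = z :^ 0 in v :* (one :- z :* q) :* f :=
             v :* (f :- z :* q :* f))
           refl (V k) z Q m′ ⟩
      V k * (m′ - z * Q * m′)
        ≈⟨ *-congˡ (+-congʳ (M-step k)) ⟩
      V k * (M k + Q * (z * (m′ + d (suc k) * F k)) - z * Q * m′)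
        ≈⟨ solve 7 (λ v z q m n e g →
             v :* (m :+ q :* (z :* (n :+ e :* g)) :- z :* q :* n) := v :* m :+ e :* (z :* q :* (v :* g)))
           refl (V k) z Q (M k) m′ (d (suc k)) (F k) ⟩
      V k * M k + d (suc k) * (z * Q * (V k * F k))
        ≈⟨ +-congˡ (*-congˡ (VF-step k)) ⟨
      V k * M k + d (suc k) * (V (suc k) * F (suc k)) ∎
      where
      Q  = q ^ suc k
      m′ = M (suc k)

    -- The successive ratios of `d` alternate between -1 and z. Together with the factor z q^(k+1)
    -- of `VF-step` they give r^(2n+1) and r^(2n+2), the increments of triangular exponents.
    d-odd : ∀ n → d (suc (n ℕ.* 2)) ≈ - d (n ℕ.* 2)
    d-odd zero    = trans d₁ (-‿cong (sym d₀))
    d-odd (suc n) = begin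
      d (suc (suc n ℕ.* 2))          ≈⟨ d-step (suc (n ℕ.* 2)) ⟩
      - (z * d (suc (n ℕ.* 2)))      ≈⟨ -‿cong (*-congˡ (d-odd n)) ⟩
      - (z * - d (n ℕ.* 2))          ≈⟨ solve 2 (λ z e → :- (z :* :- e) := :- (:- (z :* e))) refl z (d (n ℕ.* 2)) ⟩
      - - (z * d (n ℕ.* 2))          ≈⟨ -‿cong (d-step (n ℕ.* 2)) ⟨
      - d (suc n ℕ.* 2)              ∎

    d-even : ∀ n → d (suc n ℕ.* 2) ≈ z * d (suc (n ℕ.* 2))
    d-even n = begin
      d (suc n ℕ.* 2)           ≈⟨ d-step (n ℕ.* 2) ⟩
      - (z * d (n ℕ.* 2))       ≈⟨ solve 2 (λ z e → :- (z :* e) := z :* :- e) refl z (d (n ℕ.* 2)) ⟩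
      z * - d (n ℕ.* 2)         ≈⟨ *-congˡ (d-odd n) ⟨
      z * d (suc (n ℕ.* 2))     ∎

    -- V k * F k is z^k q^(k(k+1)/2), and d k z^k = (-z)^(k(k+1)/2).
    dVF-even : ∀ n → d (n ℕ.* 2) * (V (n ℕ.* 2) * F (n ℕ.* 2)) ≈ x n ^ n
    dVF-odd  : ∀ n → d (suc (n ℕ.* 2)) * (V (suc (n ℕ.* 2)) * F (suc (n ℕ.* 2))) ≈ x n ^ suc n

    dVF-even zero    = trans (*-cong d₀ (*-congˡ F₀)) (trans (*-identityˡ _) (*-identityˡ 1#))
    dVF-even (suc n) = begin
      d (suc k) * (V (suc k) * F (suc k))
        ≈⟨ *-cong (d-even n) (VF-step k) ⟩
      z * d k * (z * q ^ suc k * (V k * F k))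
        ≈⟨ solve 4 (λ z e q w →
             z :* e :* (z :* q :* w) :=
             z :* z :* (q :* (e :* w)))
           refl z (d k) (q ^ suc k) (V k * F k) ⟩
      z * z * (q ^ suc k * (d k * (V k * F k)))
        ≈⟨ *-cong z²≈1 (*-cong (sym (rx≈ n)) (dVF-odd n)) ⟩
      1# * (r * x n * x n ^ suc n)
        ≈⟨ solve 3 (λ r w y →
             let one = r :^ 0 in one :* (r :* (r :* w) :* y) :=
             y :* (r :* r :* w))
           refl r (p n) (x n ^ suc n) ⟩
      x n ^ suc n * (r * r) ^ suc n
        ≈⟨ ^-distrib-* (x n) (r * r) (suc n) ⟨
      (x n * (r * r)) ^ suc n
        ≈⟨ ^-congˡ (suc n) (x-suc n) ⟨
      x (suc n) ^ suc n ∎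
      where k = suc (n ℕ.* 2)
    dVF-odd n = begin
      d (suc k) * (V (suc k) * F (suc k))
        ≈⟨ *-cong (d-odd n) (VF-step k) ⟩
      - d k * (z * q ^ suc k * (V k * F k))
        ≈⟨ solve 4 (λ z e q w →
             :- e :* (z :* q :* w) :=
             :- (z :* q) :* (e :* w))
           refl z (d k) (q ^ suc k) (V k * F k) ⟩
      - (z * q ^ suc k) * (d k * (V k * F k))
        ≈⟨ *-cong (sym (x≈ n)) (dVF-even n) ⟩
      x n ^ suc n ∎
      where k = n ℕ.* 2

    V*M≈S : ∀ n → V (n ℕ.* 2) * M (n ℕ.* 2) ≈ S n
    V*M≈S zero    = trans (*-congˡ M₀) (*-identityˡ 1#)
    V*M≈S (suc n) = begin
      V (suc (suc k)) * M (suc (suc k))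
        ≈⟨ VM-step (suc k) ⟩
      V (suc k) * M (suc k) + d (suc (suc k)) * (V (suc (suc k)) * F (suc (suc k)))
        ≈⟨ +-cong (VM-step k) (dVF-even (suc n)) ⟩
      V k * M k + d (suc k) * (V (suc k) * F (suc k)) + x (suc n) ^ suc n
        ≈⟨ +-congʳ (+-cong (V*M≈S n) (dVF-odd n)) ⟩
      S (suc n) ∎
      where k = n ℕ.* 2

    -- All denominators at once: `B n` from Gauss's identity and `V` from the mex series.
    U : ℕ → Carrier
    U n = B n * V (n ℕ.* 2)

    -- The factors of `B n` and `P n` are 1 + z q^i for odd and even i ≤ 2n. Each pairs with the
    -- factor 1 - z q^i of `V` to give 1 - q^(2i) = 1 - r^(2i).
    U*P≈A : ∀ n → U n * P n ≈ A (n ℕ.* 2)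
    U*P≈A zero    = trans (*-cong (*-identityˡ 1#) P₀) (*-identityˡ 1#)
    U*P≈A (suc n) = begin
      B n * (1# - x n) * (V k * (1# - z * (q * Q)) * (1# - z * (q * (q * Q)))) * P (suc n)
        ≈⟨ *-congˡ (P-step n) ⟩
      B n * (1# - x n) * (V k * (1# - z * (q * Q)) * (1# - z * (q * (q * Q))))
        * (P n + q * (q * Q) * (z * P n))
        ≈⟨ *-cong (*-congˡ (*-cong (*-congˡ (+-congˡ (-‿cong (*-congˡ (*-congˡ Q≈p)))))
                                   (+-congˡ (-‿cong (*-congˡ (*-congˡ (*-congˡ Q≈p)))))))
                  (+-congˡ (*-congʳ (*-congˡ (*-congˡ Q≈p)))) ⟩
      B n * (1# - x n) * (V k * (1# - z * (q * p n)) * (1# - z * (q * (q * p n))))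
        * (P n + q * (q * p n) * (z * P n))
        ≈⟨ solve 6 (λ b v c z q w → let one = z :^ 0 in
             b :* (one :- :- (z :* q) :* w) :* (v :* (one :- z :* (q :* w)) :* (one :- z :* (q :* (q :* w))))
               :* (c :+ q :* (q :* w) :* (z :* c)) :=
             b :* v :* c :* (one :- z :* z :* (q :* q :* (w :* w)))
               :* (one :- z :* z :* (q :* q :* (q :* q) :* (w :* w))))
           refl (B n) (V k) (P n) z q (p n) ⟩
      U n * P n * (1# - z * z * (q * q * (p n * p n))) * (1# - z * z * (q * q * (q * q) * (p n * p n)))
        -- In the last factor z² is padded to z⁴ to match q⁴, so that both factors become
        -- polynomials in r = -(z q) without further use of z² = 1.
        ≈⟨ *-cong (*-congʳ (U*P≈A n)) (+-congˡ (-‿cong (*-congʳ z²≈z⁴))) ⟩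
      A k * (1# - z * z * (q * q * (p n * p n))) * (1# - z * z * (z * z) * (q * q * (q * q) * (p n * p n)))
        ≈⟨ solve 5 (λ a z q w w² → let one = z :^ 0 ; r = :- (z :* q) in
             a :* (one :- z :* z :* (q :* q :* w²))
               :* (one :- z :* z :* (z :* z) :* (q :* q :* (q :* q) :* w²)) :=
             a :* (one :- r :* (r :* w²)) :* (one :- r :* (r :* (r :* r :* w²))))
           refl (A k) z q (p n) (p n * p n) ⟩
      A k * (1# - r * (r * (p n * p n))) * (1# - r * (r * (r * r * (p n * p n))))
        ≈⟨ *-cong (*-congˡ (+-congˡ (-‿cong (*-congˡ (*-congˡ p²≈)))))
                  (+-congˡ (-‿cong (*-congˡ (*-congˡ (*-congˡ p²≈))))) ⟩
      A (suc (suc k)) ∎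
      where
      k = n ℕ.* 2
      Q = q ^ k
      Q≈p : Q ≈ p n
      Q≈p = q^[n*2]≈p n
      z²≈z⁴ : z * z ≈ z * z * (z * z)
      z²≈z⁴ = sym (trans (*-congˡ z²≈1) (*-identityʳ (z * z)))
      p²≈ : p n * p n ≈ (r * r) ^ k
      p²≈ = sym (trans (^-double (r * r) n) (^-distrib-* (r * r) (r * r) n))

    -- Both products are congruent to `A n` modulo x n, which is q^(2n+1) up to the factor -z: U M
    -- by Shanks' identity and `L-mod`, U P by `A-mod`.
    U*[M-P] : ∀ n → ∃ λ t → U n * (M (n ℕ.* 2) - P n) ≈ q ^ suc (n ℕ.* 2) * t
    U*[M-P] n with L-mod n (x n) | A-mod n n
    ... | t , L≈ | s , A≈ = - (z * (t - s)) , (begin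
      B n * V k * (M k - P n)
        ≈⟨ solve 4 (λ b v m c →
             b :* v :* (m :- c) :=
             b :* (v :* m) :- b :* v :* c)
           refl (B n) (V k) (M k) (P n) ⟩
      B n * (V k * M k) - U n * P n
        ≈⟨ +-cong (trans (*-congˡ (V*M≈S n)) (trans (B*S≈L n) L≈))
                  (-‿cong (trans (U*P≈A n) (trans (reflexive (≡.cong A n*2≡n+n)) A≈))) ⟩
      A n + x n * t - (A n + x n * s)
        ≈⟨ +-cong (+-congˡ (*-congʳ (x≈ n))) (-‿cong (+-congˡ (*-congʳ (x≈ n)))) ⟩
      A n + - (z * Q) * t - (A n + - (z * Q) * s)
        ≈⟨ solve 5 (λ a z q t s →
             a :+ :- (z :* q) :* t :- (a :+ :- (z :* q) :* s) :=
             q :* :- (z :* (t :- s)))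
           refl (A n) z Q t s ⟩
      Q * - (z * (t - s)) ∎)
      where
      k = n ℕ.* 2
      Q = q ^ suc k
      n*2≡n+n : n ℕ.* 2 ≡.≡ n ℕ.+ n
      n*2≡n+n = ≡.trans (ℕ.*-comm n 2) (≡.cong (n ℕ.+_) (ℕ.+-identityʳ n))

open import Data.Nat using (_+_; _*_)
open import Relation.Binary.PropositionalEquality

-- Formal power series over ℤ

Series : Set
Series = ℕ → ℤ

infix  8 ⊖_
infixl 7 _⊛_
infixl 6 _⊕_

-- The Cauchy product, from the decomposition f = f 0 + X (f ∘ suc). The ring laws become inductions
-- on the degree with f replaced by its tail, and no sums over pairs of indices occur.
_⊕_ _⊛_ : Series → Series → Series
(f ⊕ g) n = f n ℤ.+ g n
(f ⊛ g) zero    = f 0 ℤ.* g 0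
(f ⊛ g) (suc n) = f 0 ℤ.* g (suc n) ℤ.+ (f ∘ suc ⊛ g) n

⊖_ : Series → Series
(⊖ f) n = ℤ.- f n

0ˢ X : Series
0ˢ _ = 0ℤ

const : ℤ → Series
const k zero    = k
const k (suc n) = 0ℤ

X zero    = 0ℤ
X (suc n) = const 1ℤ n

⊛-cong : ∀ {f f′ g g′} → f ≗ f′ → g ≗ g′ → f ⊛ g ≗ f′ ⊛ g′
⊛-cong p q zero    = cong₂ ℤ._*_ (p 0) (q 0)
⊛-cong p q (suc n) = cong₂ ℤ._+_ (cong₂ ℤ._*_ (p 0) (q (suc n))) (⊛-cong (p ∘ suc) q n)

⊛-congˡ : ∀ f {g g′} → g ≗ g′ → f ⊛ g ≗ f ⊛ g′
⊛-congˡ f = ⊛-cong {f} (λ _ → refl)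

⊛-distribʳ : ∀ h f g → (f ⊕ g) ⊛ h ≗ f ⊛ h ⊕ g ⊛ h
⊛-distribʳ h f g zero    = ℤ.*-distribʳ-+ (h 0) (f 0) (g 0)
⊛-distribʳ h f g (suc n) = trans
  (cong (ℤ._+_ ((f 0 ℤ.+ g 0) ℤ.* h (suc n))) (⊛-distribʳ h (f ∘ suc) (g ∘ suc) n))
  (rearrange (f 0) (g 0) (h (suc n)) ((f ∘ suc ⊛ h) n) ((g ∘ suc ⊛ h) n))
  where
  rearrange : ∀ a b c d e → (a ℤ.+ b) ℤ.* c ℤ.+ (d ℤ.+ e) ≡ (a ℤ.* c ℤ.+ d) ℤ.+ (b ℤ.* c ℤ.+ e)
  rearrange = solve-∀

⊛-scale : ∀ k f g n → ((λ i → k ℤ.* f i) ⊛ g) n ≡ k ℤ.* (f ⊛ g) n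
⊛-scale k f g zero    = ℤ.*-assoc k (f 0) (g 0)
⊛-scale k f g (suc n) = trans
  (cong (ℤ._+_ (k ℤ.* f 0 ℤ.* g (suc n))) (⊛-scale k (f ∘ suc) g n))
  (rearrange k (f 0) (g (suc n)) ((f ∘ suc ⊛ g) n))
  where
  rearrange : ∀ k a b c → k ℤ.* a ℤ.* b ℤ.+ k ℤ.* c ≡ k ℤ.* (a ℤ.* b ℤ.+ c)
  rearrange = solve-∀

⊛-assoc : ∀ f g h → (f ⊛ g) ⊛ h ≗ f ⊛ (g ⊛ h)
⊛-assoc f g h zero    = ℤ.*-assoc (f 0) (g 0) (h 0)
⊛-assoc f g h (suc n) = trans
  (cong (ℤ._+_ (f 0 ℤ.* g 0 ℤ.* h (suc n))) (trans
    (⊛-distribʳ h (λ i → f 0 ℤ.* g (suc i)) (f ∘ suc ⊛ g) n)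
    (cong₂ ℤ._+_ (⊛-scale (f 0) (g ∘ suc) h n) (⊛-assoc (f ∘ suc) g h n))))
  (rearrange (f 0) (g 0) (h (suc n)) ((g ∘ suc ⊛ h) n) ((f ∘ suc ⊛ (g ⊛ h)) n))
  where
  rearrange : ∀ a b c d e → a ℤ.* b ℤ.* c ℤ.+ (a ℤ.* d ℤ.+ e) ≡ a ℤ.* (b ℤ.* c ℤ.+ d) ℤ.+ e
  rearrange = solve-∀

-- The definition peels the first factor; peeling the second one as well is what commutativity
-- requires.
⊛-suc : ∀ f g n → (f ⊛ g) (suc n) ≡ f (suc n) ℤ.* g 0 ℤ.+ (f ⊛ g ∘ suc) n
⊛-suc f g zero    = ℤ.+-comm (f 0 ℤ.* g 1) (f 1 ℤ.* g 0)
⊛-suc f g (suc n) = trans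
  (cong (ℤ._+_ (f 0 ℤ.* g (suc (suc n)))) (⊛-suc (f ∘ suc) g n))
  (rearrange (f 0 ℤ.* g (suc (suc n))) (f (suc (suc n)) ℤ.* g 0) ((f ∘ suc ⊛ g ∘ suc) n))
  where
  rearrange : ∀ a b c → a ℤ.+ (b ℤ.+ c) ≡ b ℤ.+ (a ℤ.+ c)
  rearrange = solve-∀

⊛-comm : ∀ f g → f ⊛ g ≗ g ⊛ f
⊛-comm f g zero    = ℤ.*-comm (f 0) (g 0)
⊛-comm f g (suc n) = trans
  (cong₂ ℤ._+_ (ℤ.*-comm (f 0) (g (suc n))) (⊛-comm (f ∘ suc) g n))
  (sym (⊛-suc g f n))

⊛-zeroˡ : ∀ g → 0ˢ ⊛ g ≗ 0ˢ
⊛-zeroˡ g zero    = refl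
⊛-zeroˡ g (suc n) = trans (ℤ.+-identityˡ _) (⊛-zeroˡ g n)

const-⊛ : ∀ k g n → (const k ⊛ g) n ≡ k ℤ.* g n
const-⊛ k g zero    = refl
const-⊛ k g (suc n) = trans (cong (ℤ._+_ (k ℤ.* g (suc n))) (⊛-zeroˡ g n)) (ℤ.+-identityʳ _)

⊛-identityˡ : ∀ g → const 1ℤ ⊛ g ≗ g
⊛-identityˡ g n = trans (const-⊛ 1ℤ g n) (ℤ.*-identityˡ (g n))

series : CommutativeRing 0ℓ 0ℓ
series = record
  { Carrier = Series
  ; _≈_ = _≗_
  ; _+_ = _⊕_
  ; _*_ = _⊛_
  ; -_  = ⊖_
  ; 0#  = 0ˢ
  ; 1#  = const 1ℤ
  ; isCommutativeRing = record
    { isRing = record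
      { +-isAbelianGroup = Pointwise.isAbelianGroup ℕ ℤ.+-0-isAbelianGroup
      ; *-cong     = ⊛-cong
      ; *-assoc    = ⊛-assoc
      ; *-identity = ⊛-identityˡ , λ g n → trans (⊛-comm g _ n) (⊛-identityˡ g n)
      ; distrib    = (λ h f g n → trans (⊛-comm h (f ⊕ g) n)
                       (trans (⊛-distribʳ h f g n) (cong₂ ℤ._+_ (⊛-comm f h n) (⊛-comm g h n))))
                   , ⊛-distribʳ
      }
    ; *-comm = ⊛-comm
    }
  }

const-homo : ℤ.+-*-rawRing -Raw-AlmostCommutative⟶ fromCommutativeRing series
const-homo = record
  { ⟦_⟧    = const
  ; +-homo = λ { k l zero → refl ; k l (suc n) → refl }
  ; *-homo = λ { k l zero → refl ; k l (suc n) → sym (trans (const-⊛ k (const l) (suc n)) (ℤ.*-zeroʳ k)) }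
  ; -‿homo = λ { k zero → refl ; k (suc n) → refl }
  ; 0-homo = λ { zero → refl ; (suc n) → refl }
  ; 1-homo = λ n → refl
  }

-- Stands in for division by g. Degree 0 forces f 0 = 0, after which f ⊛ g is X times (f ∘ suc) ⊛ g
-- and the degree drops by one.
⊛-cancel : ∀ n f g → g 0 ≡ 1ℤ → (∀ i → i ≤ n → (f ⊛ g) i ≡ 0ℤ) → f n ≡ 0ℤ
⊛-cancel zero f g g₀ fg≡0 =
  trans (sym (trans (cong (f 0 ℤ.*_) g₀) (ℤ.*-identityʳ (f 0)))) (fg≡0 0 z≤n)
⊛-cancel (suc n) f g g₀ fg≡0 = ⊛-cancel n (f ∘ suc) g g₀ λ i i≤n →
  trans (sym (ℤ.+-identityˡ _))
    (trans (cong (λ k → k ℤ.* g (suc i) ℤ.+ (f ∘ suc ⊛ g) i) (sym f₀≡0)) (fg≡0 (suc i) (s≤s i≤n)))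
  where
  f₀≡0 : f 0 ≡ 0ℤ
  f₀≡0 = ⊛-cancel zero f g g₀ λ { zero _ → fg≡0 0 z≤n }

X-⊛ : ∀ f n → (X ⊛ f) (suc n) ≡ f n
X-⊛ f n = trans (ℤ.+-identityˡ _) (⊛-identityˡ f n)

open import Algebra.Properties.CommutativeSemiring.Exp
  (CommutativeRing.commutativeSemiring series) using (_^_)

X^-⊛-below : ∀ k f {n} → n < k → (X ^ k ⊛ f) n ≡ 0ℤ
X^-⊛-below (suc k) f {zero}  _         = cong (ℤ._* f 0) (ℤ.*-zeroˡ ((X ^ k) 0))
X^-⊛-below (suc k) f {suc n} (s≤s n<k) = trans (⊛-assoc X (X ^ k) f (suc n))
  (trans (X-⊛ (X ^ k ⊛ f) n) (X^-⊛-below k f n<k))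

X^-⊛-shift : ∀ k f n → (X ^ k ⊛ f) (k + n) ≡ f n
X^-⊛-shift zero    f n = ⊛-identityˡ f n
X^-⊛-shift (suc k) f n = trans (⊛-assoc X (X ^ k) f (suc (k + n)))
  (trans (X-⊛ (X ^ k ⊛ f) (k + n)) (X^-⊛-shift k f n))

-- Weighted sums over lists

private variable
  A : Set

∑ : List A → (A → ℤ) → ℤ
∑ []       w = 0ℤ
∑ (x ∷ xs) w = w x ℤ.+ ∑ xs w

∑-cong : ∀ (xs : List A) {w v} → (∀ {x} → x ∈ xs → w x ≡ v x) → ∑ xs w ≡ ∑ xs v
∑-cong []       w≡v = refl
∑-cong (x ∷ xs) w≡v = cong₂ ℤ._+_ (w≡v (here refl)) (∑-cong xs (w≡v ∘ there))

∑-↭ : ∀ {xs ys : List A} w → xs ↭ ys → ∑ xs w ≡ ∑ ys w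
∑-↭ w ↭.refl          = refl
∑-↭ w (↭.prep x p)    = cong (ℤ._+_ (w x)) (∑-↭ w p)
∑-↭ w (↭.swap {xs} {ys} x y p) = trans
  (cong (λ k → w x ℤ.+ (w y ℤ.+ k)) (∑-↭ w p))
  (exchange (w x) (w y) (∑ ys w))
  where
  exchange : ∀ a b c → a ℤ.+ (b ℤ.+ c) ≡ b ℤ.+ (a ℤ.+ c)
  exchange = solve-∀
∑-↭ w (↭.trans p q)   = trans (∑-↭ w p) (∑-↭ w q)

∑-++ : ∀ (xs ys : List A) w → ∑ (xs ++ ys) w ≡ ∑ xs w ℤ.+ ∑ ys w
∑-++ []       ys w = sym (ℤ.+-identityˡ (∑ ys w))
∑-++ (x ∷ xs) ys w = trans (cong (ℤ._+_ (w x)) (∑-++ xs ys w)) (sym (ℤ.+-assoc (w x) (∑ xs w) (∑ ys w)))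

∑-map : ∀ {B : Set} (f : B → A) (xs : List B) w → ∑ (map f xs) w ≡ ∑ xs (w ∘ f)
∑-map f []       w = refl
∑-map f (x ∷ xs) w = cong (ℤ._+_ (w (f x))) (∑-map f xs w)

∑-+ : ∀ (xs : List A) w v → ∑ xs (λ x → w x ℤ.+ v x) ≡ ∑ xs w ℤ.+ ∑ xs v
∑-+ []       w v = refl
∑-+ (x ∷ xs) w v = trans (cong (ℤ._+_ (w x ℤ.+ v x)) (∑-+ xs w v)) (exchange (w x) (v x) (∑ xs w) (∑ xs v))
  where
  exchange : ∀ a b c d → (a ℤ.+ b) ℤ.+ (c ℤ.+ d) ≡ (a ℤ.+ c) ℤ.+ (b ℤ.+ d)
  exchange = solve-∀

∑-* : ∀ (xs : List A) k w → ∑ xs (λ x → k ℤ.* w x) ≡ k ℤ.* ∑ xs w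
∑-* []       k w = sym (ℤ.*-zeroʳ k)
∑-* (x ∷ xs) k w = trans (cong (ℤ._+_ (k ℤ.* w x)) (∑-* xs k w)) (sym (ℤ.*-distribˡ-+ k (w x) (∑ xs w)))

∑-zero : ∀ (xs : List A) {w} → (∀ {x} → x ∈ xs → w x ≡ 0ℤ) → ∑ xs w ≡ 0ℤ
∑-zero []       w≡0 = refl
∑-zero (x ∷ xs) w≡0 = cong₂ ℤ._+_ (w≡0 (here refl)) (∑-zero xs (w≡0 ∘ there))

-- Weighted enumeration of partitions by largest part

restricted : ℕ → ℕ → List (List ℕ)
restricted N n = filter (all? (ℕ._≤? N)) (partitions n)

∈-restricted⁺ : ∀ {N n xs} → IsPartition n xs → All (_≤ N) xs → xs ∈ restricted N n
∈-restricted⁺ {N} p b = ∈-filter⁺ (all? (ℕ._≤? N)) (Equivalence.from ∈-partitions p) b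

∈-restricted⁻ : ∀ {N n xs} → xs ∈ restricted N n → IsPartition n xs × All (_≤ N) xs
∈-restricted⁻ {N} {n} i with ∈-filter⁻ (all? (ℕ._≤? N)) {xs = partitions n} i
... | j , b = Equivalence.to ∈-partitions j , b

restricted-unique : ∀ N n → Unique (restricted N n)
restricted-unique N n = Unique.filter⁺ (all? (ℕ._≤? N)) (partitions-unique n)

restricted-all : ∀ {N n} → n ≤ N → restricted N n ≡ partitions n
restricted-all {N} {n} n≤N = filter-all (all? (ℕ._≤? N)) (All.tabulate λ i →
  All.tabulate λ j → ℕ.≤-trans (∈⇒≤sum j)
    (ℕ.≤-trans (ℕ.≤-reflexive (IsPartition.total (Equivalence.to ∈-partitions i))) n≤N))

≤-suc : ∀ {N} {xs : List ℕ} → All (_≤ N) xs → All (_≤ suc N) xs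
≤-suc = All.map (λ x≤N → ℕ.m≤n⇒m≤1+n x≤N)

Linked-∷ : ∀ {N xs} → All (_≤ N) xs → Linked _≥_ xs → Linked _≥_ (N ∷ xs)
Linked-∷ []      []      = [-]
Linked-∷ (x ∷ _) ys      = x ∷ ys

Linked-tail : ∀ {x} {xs : List ℕ} → Linked _≥_ (x ∷ xs) → Linked _≥_ xs × All (_≤ x) xs
Linked-tail [-]     = [] , []
Linked-tail (p ∷ l) = l , Linked⇒All (flip ℕ.≤-trans) p l

-- Since the parts decrease, a part N + 1 under the bound N + 1 can only be detected at, and removed
-- from, the head.
largest-part : ∀ {N n xs} → IsPartition n xs → All (_≤ suc N) xs →
  All (_≤ N) xs ⊎ (∃ λ m → n ≡ suc N + m × ∃ λ ys → xs ≡ suc N ∷ ys × ys ∈ restricted (suc N) m)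
largest-part {xs = []}     p _ = inj₁ []
largest-part {xs = x ∷ ys} (isPartition (_ ∷ pos) dec refl) (x≤1+N ∷ b)
  with Linked-tail dec | ℕ.m≤n⇒m<n∨m≡n x≤1+N
... | _    , ys≤x | inj₁ x<1+N =
  inj₁ (ℕ.≤-pred x<1+N ∷ All.map (λ y≤x → ℕ.≤-trans y≤x (ℕ.≤-pred x<1+N)) ys≤x)
... | dec′ , ys≤x | inj₂ refl  =
  inj₂ (ℕ.sum ys , refl , ys , refl , ∈-restricted⁺ (isPartition pos dec′ refl) b)

restricted-suc-< : ∀ {N n} → n < suc N → restricted (suc N) n ↭ restricted N n
restricted-suc-< {N} {n} n<1+N = ∼bag⇒↭ (unique∧set⇒bag
  (restricted-unique (suc N) n) (restricted-unique N n) (mk⇔ to from))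
  where
  to : ∀ {xs} → xs ∈ restricted (suc N) n → xs ∈ restricted N n
  to i with ∈-restricted⁻ {suc N} {n} i
  ... | p , b with largest-part p b
  ...   | inj₁ b′             = ∈-restricted⁺ p b′
  ...   | inj₂ (m , refl , _) = contradiction (ℕ.m≤m+n (suc N) m) (ℕ.<⇒≱ n<1+N)
  from : ∀ {xs} → xs ∈ restricted N n → xs ∈ restricted (suc N) n
  from i with ∈-restricted⁻ {N} {n} i
  ... | p , b = ∈-restricted⁺ p (≤-suc b)

-- The order of enumeration is irrelevant: duplicate-free lists with the same members are
-- permutations of each other, and sums respect permutations.
restricted-suc-+ : ∀ N m →
  restricted (suc N) (suc N + m) ↭ restricted N (suc N + m) ++ map (suc N ∷_) (restricted (suc N) m)
restricted-suc-+ N m = ∼bag⇒↭ (unique∧set⇒bag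
  (restricted-unique (suc N) n)
  (Unique.++⁺ (restricted-unique N n) (Unique.map⁺ ∷-injectiveʳ (restricted-unique (suc N) m)) disjoint)
  (mk⇔ to from))
  where
  n = suc N + m
  without = restricted N n
  with-N  = map (suc N ∷_) (restricted (suc N) m)

  disjoint : ∀ {xs} → xs ∈ without × xs ∈ with-N → _
  disjoint (i , j) with ∈-map⁻ (suc N ∷_) j
  ... | ys , _ , refl with ∈-restricted⁻ {N} {n} i
  ...   | _ , (1+N≤N ∷ _) = ℕ.<-irrefl refl 1+N≤N

  to : ∀ {xs} → xs ∈ restricted (suc N) n → xs ∈ without ++ with-N
  to i with ∈-restricted⁻ {suc N} {n} i
  ... | p , b with largest-part p b
  ...   | inj₁ b′ = ∈-++⁺ˡ (∈-restricted⁺ p b′)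
  ...   | inj₂ (m′ , eq , ys , refl , j) with ℕ.+-cancelˡ-≡ (suc N) m m′ eq
  ...     | refl = ∈-++⁺ʳ without (∈-map⁺ (suc N ∷_) j)

  from : ∀ {xs} → xs ∈ without ++ with-N → xs ∈ restricted (suc N) n
  from i with ∈-++⁻ without i
  ... | inj₁ j with ∈-restricted⁻ {N} {n} j
  ...   | p , b = ∈-restricted⁺ p (≤-suc b)
  from i | inj₂ j with ∈-map⁻ (suc N ∷_) j
  ... | ys , k , refl with ∈-restricted⁻ {suc N} {m} k
  ...   | isPartition pos dec refl , b =
    ∈-restricted⁺ (isPartition (s≤s z≤n ∷ pos) (Linked-∷ b dec) refl) (ℕ.≤-refl ∷ b)

genFun : ℕ → (List ℕ → ℤ) → Series
genFun N w n = ∑ (restricted N n) w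

∈-restricted⇒bounded : ∀ N n {xs} → xs ∈ restricted N n → All (_≤ N) xs
∈-restricted⇒bounded N n i = proj₂ (∈-restricted⁻ {N} {n} i)

genFun-cong : ∀ N {w v} → (∀ {xs} → All (_≤ N) xs → w xs ≡ v xs) → genFun N w ≗ genFun N v
genFun-cong N w≡v n = ∑-cong (restricted N n) (w≡v ∘ ∈-restricted⇒bounded N n)

genFun-zero : ∀ N {w} → (∀ {xs} → All (_≤ N) xs → w xs ≡ 0ℤ) → genFun N w ≗ 0ˢ
genFun-zero N w≡0 n = ∑-zero (restricted N n) (w≡0 ∘ ∈-restricted⇒bounded N n)

genFun-+ : ∀ N w v → genFun N (λ xs → w xs ℤ.+ v xs) ≗ genFun N w ⊕ genFun N v
genFun-+ N w v n = ∑-+ (restricted N n) w v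

genFun-* : ∀ N k w → genFun N (λ xs → k ℤ.* w xs) ≗ const k ⊛ genFun N w
genFun-* N k w n = trans (∑-* (restricted N n) k w) (sym (const-⊛ k (genFun N w) n))

genFun₀ : ∀ w → genFun 0 w ≗ const (w [])
genFun₀ w zero    = ℤ.+-identityʳ (w [])
genFun₀ w (suc n) = cong (flip ∑ w) (empty (restricted 0 (suc n)) no-partition)
  where
  empty : ∀ (xss : List (List ℕ)) → (∀ {xs} → xs ∉ xss) → xss ≡ []
  empty []        _  = refl
  empty (xs ∷ xss) ∉ = contradiction (here refl) ∉

  no-partition : ∀ {xs} → xs ∉ restricted 0 (suc n)
  no-partition {[]} i with ∈-restricted⁻ {0} {suc n} i
  ... | isPartition _ _ () , _
  no-partition {x ∷ xs} i with ∈-restricted⁻ {0} {suc n} i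
  ... | isPartition (1≤x ∷ _) _ _ , (x≤0 ∷ _) = contradiction x≤0 (ℕ.<⇒≱ 1≤x)

-- Removing one largest part leaves the bound at N + 1, because that part may be repeated. Hence the
-- recurrences for `F` and `M` are implicit.
genFun-suc : ∀ N w → genFun (suc N) w ≗ genFun N w ⊕ X ^ suc N ⊛ genFun (suc N) (w ∘ (suc N ∷_))
genFun-suc N w n with n ℕ.<? suc N
... | yes n<1+N = begin
  ∑ (restricted (suc N) n) w ≡⟨ ∑-↭ w (restricted-suc-< n<1+N) ⟩
  genFun N w n                    ≡⟨ ℤ.+-identityʳ (genFun N w n) ⟨
  genFun N w n ℤ.+ 0ℤ             ≡⟨ cong (ℤ._+_ (genFun N w n)) (X^-⊛-below (suc N) _ n<1+N) ⟨
  _ ∎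
  where open ≡-Reasoning
... | no n≮1+N with ℕ.≮⇒≥ n≮1+N
...   | 1+N≤n rewrite sym (ℕ.m+[n∸m]≡n 1+N≤n) = begin
  ∑ (restricted (suc N) n′) w
    ≡⟨ ∑-↭ w (restricted-suc-+ N m) ⟩
  ∑ (restricted N n′ ++ map (suc N ∷_) (restricted (suc N) m)) w
    ≡⟨ ∑-++ (restricted N n′) _ w ⟩
  genFun N w n′ ℤ.+ ∑ (map (suc N ∷_) (restricted (suc N) m)) w
    ≡⟨ cong (ℤ._+_ (genFun N w n′)) (∑-map (suc N ∷_) (restricted (suc N) m) w) ⟩
  genFun N w n′ ℤ.+ genFun (suc N) (w ∘ (suc N ∷_)) m
    ≡⟨ cong (ℤ._+_ (genFun N w n′)) (X^-⊛-shift (suc N) _ m) ⟨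
  _ ∎
  where
  open ≡-Reasoning
  m = n ℕ.∸ suc N
  n′ = suc N + m

genFun-suc-vanish : ∀ N w → (∀ {xs} → All (_≤ suc N) xs → w (suc N ∷ xs) ≡ 0ℤ) → genFun (suc N) w ≗ genFun N w
genFun-suc-vanish N w w≡0 n = trans (genFun-suc N w n) (trans
  (cong (ℤ._+_ (genFun N w n)) (trans
    (⊛-congˡ (X ^ suc N) (genFun-zero (suc N) w≡0) n)
    (trans (⊛-comm (X ^ suc N) 0ˢ n) (⊛-zeroˡ (X ^ suc N) n))))
  (ℤ.+-identityʳ (genFun N w n)))

open _-Raw-AlmostCommutative⟶_ const-homo using (*-homo; -‿homo)

-- The mex after a new largest part

mex-unique : ∀ {xs m m′} → IsMex xs m → IsMex xs m′ → m ≡ m′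
mex-unique {m = m} {m′} (isMex p ∉ l) (isMex p′ ∉′ l′) with ℕ.<-cmp m m′
... | tri< m<m′ _ _ = contradiction (l′ m p m<m′) ∉
... | tri≈ _ m≡m′ _ = m≡m′
... | tri> _ _ m>m′ = contradiction (l m′ p′ m>m′) ∉′

mex≤ : ∀ {N xs} → All (_≤ N) xs → mex xs ≤ suc N
mex≤ {N} {xs} b with mex xs ℕ.≤? suc N
... | yes mex≤1+N = mex≤1+N
... | no  mex≰1+N = contradiction
  (All.lookup b (IsMex.least (mex-isMex xs) (suc N) (s≤s z≤n) (ℕ.≰⇒> mex≰1+N)))
  (ℕ.<⇒≱ (ℕ.n<1+n N))

mex-∷-≢ : ∀ {k xs} → mex xs ≢ k → mex (k ∷ xs) ≡ mex xs
mex-∷-≢ {k} {xs} mex≢k = mex-unique (mex-isMex (k ∷ xs))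
  (isMex positive missing′ λ i p q → there (least i p q))
  where
  open IsMex (mex-isMex xs)
  missing′ : mex xs ∉ k ∷ xs
  missing′ (here mex≡k) = mex≢k mex≡k
  missing′ (there i)    = missing i

mex-∷-≡ : ∀ {k xs} → All (_≤ k) xs → mex xs ≡ k → mex (k ∷ xs) ≡ suc k
mex-∷-≡ {k} {xs} b mex≡k = mex-unique (mex-isMex (k ∷ xs)) (isMex (s≤s z≤n) missing′ least′)
  where
  open IsMex (mex-isMex xs)
  missing′ : suc k ∉ k ∷ xs
  missing′ i = ℕ.<-irrefl refl (All.lookup (ℕ.≤-refl ∷ b) i)
  least′ : ∀ i → 1 ≤ i → i < suc k → i ∈ k ∷ xs
  least′ i 1≤i i<1+k with ℕ.m<1+n⇒m<n∨m≡n i<1+k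
  ... | inj₁ i<k  = there (least i 1≤i (subst (i <_) (sym mex≡k) i<k))
  ... | inj₂ refl = here refl

mex-∷-∌ : ∀ k xs → mex (k ∷ xs) ≢ k
mex-∷-∌ k xs mex≡k = IsMex.missing (mex-isMex (k ∷ xs)) (here mex≡k)

-- Indicators and counting

indicator : ∀ {P : Set} → Dec P → ℤ
indicator (yes _) = 1ℤ
indicator (no  _) = 0ℤ

indicator-yes : ∀ {P : Set} (p? : Dec P) → P → indicator p? ≡ 1ℤ
indicator-yes (yes _) p = refl
indicator-yes (no ¬p) p = contradiction p ¬p

indicator-no : ∀ {P : Set} (p? : Dec P) → ¬ P → indicator p? ≡ 0ℤ
indicator-no (yes p) ¬p = contradiction p ¬p
indicator-no (no _)  ¬p = refl

indicator-⇔ : ∀ {P Q : Set} (p? : Dec P) (q? : Dec Q) → (P → Q) → (Q → P) → indicator p? ≡ indicator q?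
indicator-⇔ (yes p) q? to from = sym (indicator-yes q? (to p))
indicator-⇔ (no ¬p) q? to from = sym (indicator-no q? (¬p ∘ from))

indicator-× : ∀ {P Q : Set} (p? : Dec P) (q? : Dec Q) → indicator (p? ×-dec q?) ≡ indicator p? ℤ.* indicator q?
indicator-× (yes _) (yes _) = refl
indicator-× (yes _) (no _)  = refl
indicator-× (no _)  q?      = refl

indicator-¬ : ∀ {P : Set} (p? : Dec P) → indicator (¬? p?) ≡ 1ℤ ℤ.- indicator p?
indicator-¬ (yes _) = refl
indicator-¬ (no _)  = refl

length-filter : ∀ {A : Set} {P : Pred A 0ℓ} (P? : Decidable P) xs →
  ℤ.+ length (filter P? xs) ≡ ∑ xs (indicator ∘ P?)
length-filter P? []       = refl
length-filter P? (x ∷ xs) with P? x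
... | yes _ = cong (ℤ._+_ 1ℤ) (length-filter P? xs)
... | no  _ = trans (length-filter P? xs) (sym (ℤ.+-identityˡ _))

δ : ℕ → ℕ → ℤ
δ k m = indicator (m ℕ.≟ k)

-- A new part k moves the mex only if the mex was k, and then by exactly one, since no part exceeds
-- k. The difference c (k + 1) - c k arising here becomes `d k`.
mex-∷ : ∀ (c : ℕ → ℤ) {k xs} → All (_≤ k) xs →
  c (mex (k ∷ xs)) ≡ c (mex xs) ℤ.+ (c (suc k) ℤ.- c k) ℤ.* δ k (mex xs)
mex-∷ c {k} {xs} b with mex xs ℕ.≟ k
... | yes mex≡k = trans (cong c (mex-∷-≡ b mex≡k)) (trans (rearrange (c (suc k)) (c k))
                    (cong (λ m → c m ℤ.+ (c (suc k) ℤ.- c k) ℤ.* 1ℤ) (sym mex≡k)))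
  where
  rearrange : ∀ a b → a ≡ b ℤ.+ (a ℤ.- b) ℤ.* 1ℤ
  rearrange = solve-∀
... | no  mex≢k = trans (cong c (mex-∷-≢ mex≢k)) (rearrange (c (mex xs)) (c (suc k) ℤ.- c k))
  where
  rearrange : ∀ a b → a ≡ a ℤ.+ b ℤ.* 0ℤ
  rearrange = solve-∀

-- The substitution of X² for X; it moves the count at m to the index 2m and so accounts for n / 2
-- in the theorem.
dilate : Series → Series
dilate f zero          = f 0
dilate f (suc zero)    = 0ℤ
dilate f (suc (suc n)) = dilate (f ∘ suc) n

dilate-cong : ∀ {f g} → f ≗ g → dilate f ≗ dilate g
dilate-cong f≗g zero          = f≗g 0
dilate-cong f≗g (suc zero)    = refl
dilate-cong f≗g (suc (suc n)) = dilate-cong (f≗g ∘ suc) n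

dilate-⊕ : ∀ f g → dilate (f ⊕ g) ≗ dilate f ⊕ dilate g
dilate-⊕ f g zero          = refl
dilate-⊕ f g (suc zero)    = refl
dilate-⊕ f g (suc (suc n)) = dilate-⊕ (f ∘ suc) (g ∘ suc) n

dilate-const : ∀ k → dilate (const k) ≗ const k
dilate-const k zero          = refl
dilate-const k (suc zero)    = refl
dilate-const k (suc (suc n)) = dilate-0 n
  where
  dilate-0 : dilate 0ˢ ≗ 0ˢ
  dilate-0 zero          = refl
  dilate-0 (suc zero)    = refl
  dilate-0 (suc (suc n)) = dilate-0 n

dilate-* : ∀ k f n → dilate (λ i → k ℤ.* f i) n ≡ k ℤ.* dilate f n
dilate-* k f zero          = refl
dilate-* k f (suc zero)    = sym (ℤ.*-zeroʳ k)
dilate-* k f (suc (suc n)) = dilate-* k (f ∘ suc) n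

dilate-const-⊛ : ∀ k f → dilate (const k ⊛ f) ≗ const k ⊛ dilate f
dilate-const-⊛ k f n = trans (dilate-cong (const-⊛ k f) n)
  (trans (dilate-* k f n) (sym (const-⊛ k (dilate f) n)))

dilate-X-⊛ : ∀ f → dilate (X ⊛ f) ≗ X ⊛ (X ⊛ dilate f)
dilate-X-⊛ f zero          = refl
dilate-X-⊛ f (suc zero)    = sym (X-⊛ (X ⊛ dilate f) 0)
dilate-X-⊛ f (suc (suc n)) = trans (dilate-cong (X-⊛ f) n)
  (sym (trans (X-⊛ (X ⊛ dilate f) (suc n)) (X-⊛ (dilate f) n)))

dilate-X^-⊛ : ∀ k f → dilate (X ^ k ⊛ f) ≗ X ^ (k * 2) ⊛ dilate f
dilate-X^-⊛ zero    f n = dilate-const-⊛ 1ℤ f n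
dilate-X^-⊛ (suc k) f n = begin
  dilate (X ⊛ X ^ k ⊛ f) n                  ≡⟨ dilate-cong (⊛-assoc X (X ^ k) f) n ⟩
  dilate (X ⊛ (X ^ k ⊛ f)) n                ≡⟨ dilate-X-⊛ (X ^ k ⊛ f) n ⟩
  (X ⊛ (X ⊛ dilate (X ^ k ⊛ f))) n          ≡⟨ ⊛-congˡ X (⊛-congˡ X (dilate-X^-⊛ k f)) n ⟩
  (X ⊛ (X ⊛ (X ^ (k * 2) ⊛ dilate f))) n  ≡⟨ ⊛-congˡ X (⊛-assoc X (X ^ (k * 2)) (dilate f)) n ⟨
  (X ⊛ (X ⊛ X ^ (k * 2) ⊛ dilate f)) n    ≡⟨ ⊛-assoc X (X ⊛ X ^ (k * 2)) (dilate f) n ⟨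
  (X ^ (suc k * 2) ⊛ dilate f) n          ∎
  where open ≡-Reasoning

dilate-even : ∀ f m → dilate f (m * 2) ≡ f m
dilate-even f zero    = refl
dilate-even f (suc m) = dilate-even (f ∘ suc) m

dilate-odd : ∀ f m → dilate f (suc (m * 2)) ≡ 0ℤ
dilate-odd f zero    = refl
dilate-odd f (suc m) = dilate-odd (f ∘ suc) m

⊛-head₁ : ∀ f g → f 0 ≡ 1ℤ → g 0 ≡ 1ℤ → (f ⊛ g) 0 ≡ 1ℤ
⊛-head₁ f g f₀ g₀ = cong₂ ℤ._*_ f₀ g₀

⊛-head₀ : ∀ f g → f 0 ≡ 0ℤ → (f ⊛ g) 0 ≡ 0ℤ
⊛-head₀ f g f₀ = cong (ℤ._* g 0) f₀

1-head₁ : ∀ f → f 0 ≡ 0ℤ → (const 1ℤ ⊕ ⊖ f) 0 ≡ 1ℤ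
1-head₁ f f₀ = cong (ℤ._-_ 1ℤ) f₀

-- The two sides as power series

module Weighted (ζ : ℤ) (ζ²≡1 : ζ ℤ.* ζ ≡ 1ℤ) where

  mexWeight : (ℕ → ℤ) → List ℕ → ℤ
  mexWeight c xs = ζ ℤ.^ length xs ℤ.* c (mex xs)

  -- Parts at most N together with mex N + 1 mean that all of 1, ..., N occur.
  F : ℕ → Series
  F N = genFun N (mexWeight (δ (suc N)))

  -- Mex N + 1 already excludes the part N + 1, so the looser bound admits nothing new.
  F-extend : ∀ N → genFun (suc N) (mexWeight (δ (suc N))) ≗ F N
  F-extend N = genFun-suc-vanish N _ λ {xs} _ →
    trans (cong (ℤ._*_ (ζ ℤ.^ suc (length xs))) (indicator-no (mex (suc N ∷ xs) ℕ.≟ suc N) (mex-∷-∌ (suc N) xs)))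
      (ℤ.*-zeroʳ (ζ ℤ.^ suc (length xs)))

  -- Kept general in c to serve twice: c = `class` is the recurrence of `M`, and a `δ` gives that of
  -- `F`.
  genFun-mex-suc : ∀ c N → genFun (suc N) (mexWeight c) ≗
    genFun N (mexWeight c)
    ⊕ X ^ suc N ⊛ (const ζ ⊛ (genFun (suc N) (mexWeight c) ⊕ const (c (2 + N) ℤ.- c (suc N)) ⊛ F N))
  genFun-mex-suc c N n = trans (genFun-suc N (mexWeight c) n) (cong (ℤ._+_ (genFun N (mexWeight c) n))
    (⊛-congˡ (X ^ suc N) inner n))
    where
    e = c (2 + N) ℤ.- c (suc N)
    rearrange : ∀ z l m e d → z ℤ.* l ℤ.* (m ℤ.+ e ℤ.* d) ≡ z ℤ.* (l ℤ.* m ℤ.+ e ℤ.* (l ℤ.* d))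
    rearrange = solve-∀
    w  = mexWeight c
    w′ = mexWeight (δ (suc N))
    inner : genFun (suc N) (w ∘ (suc N ∷_)) ≗ const ζ ⊛ (genFun (suc N) w ⊕ const e ⊛ F N)
    inner i = begin
      genFun (suc N) (w ∘ (suc N ∷_)) i
        ≡⟨ genFun-cong (suc N) (λ {xs} b → trans
             (cong (ℤ._*_ (ζ ℤ.^ suc (length xs))) (mex-∷ c b))
             (rearrange ζ (ζ ℤ.^ length xs) (c (mex xs)) e (δ (suc N) (mex xs)))) i ⟩
      genFun (suc N) (λ xs → ζ ℤ.* (w xs ℤ.+ e ℤ.* w′ xs)) i
        ≡⟨ genFun-* (suc N) ζ (λ xs → w xs ℤ.+ e ℤ.* w′ xs) i ⟩
      (const ζ ⊛ genFun (suc N) (λ xs → w xs ℤ.+ e ℤ.* w′ xs)) i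
        ≡⟨ ⊛-congˡ (const ζ) (λ j → trans (genFun-+ (suc N) w (λ xs → e ℤ.* w′ xs) j)
             (cong (ℤ._+_ (genFun (suc N) w j))
               (trans (genFun-* (suc N) e w′ j) (⊛-congˡ (const e) (F-extend N) j)))) i ⟩
      (const ζ ⊛ (genFun (suc N) w ⊕ const e ⊛ F N)) i ∎
      where open ≡-Reasoning

  -- The case c = `δ (2 + N)`: parts ≤ N allow a mex of at most N + 1, so the first summand
  -- vanishes, and the jump of c is 1.
  F-suc : ∀ N → F (suc N) ≗ X ^ suc N ⊛ (const ζ ⊛ (F (suc N) ⊕ F N))
  F-suc N n = trans (genFun-mex-suc (δ (2 + N)) N n) (trans
    (cong₂ ℤ._+_ (genFun-zero N small n) (⊛-congˡ (X ^ suc N) (⊛-congˡ (const ζ) step) n))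
    (ℤ.+-identityˡ _))
    where
    small : ∀ {xs} → All (_≤ N) xs → mexWeight (δ (2 + N)) xs ≡ 0ℤ
    small {xs} b = trans
      (cong (ℤ._*_ (ζ ℤ.^ length xs)) (indicator-no (mex xs ℕ.≟ 2 + N) (ℕ.<⇒≢ (s≤s (mex≤ b)))))
      (ℤ.*-zeroʳ (ζ ℤ.^ length xs))
    jump : δ (2 + N) (2 + N) ℤ.- δ (2 + N) (suc N) ≡ 1ℤ
    jump = cong₂ ℤ._-_ (indicator-yes (2 + N ℕ.≟ 2 + N) refl)
      (indicator-no (suc N ℕ.≟ 2 + N) (ℕ.<⇒≢ (ℕ.n<1+n (suc N))))
    step : F (suc N) ⊕ const (δ (2 + N) (2 + N) ℤ.- δ (2 + N) (suc N)) ⊛ F N ≗ F (suc N) ⊕ F N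
    step i = cong (ℤ._+_ (F (suc N) i)) (trans (cong (λ k → (const k ⊛ F N) i) jump) (⊛-identityˡ (F N) i))

  -- The m-th value is [m ≡ 1 mod 4] - ζ [m ≡ 3 mod 4].
  class : ℕ → ℤ
  class zero          = 0ℤ
  class (suc zero)    = 1ℤ
  class (suc (suc m)) = ℤ.- (ζ ℤ.* class m)

  M : ℕ → Series
  M N = genFun N (mexWeight class)

  d : ℕ → Series
  d k = const (class (suc k) ℤ.- class k)

  d₁ : d 1 ≗ ⊖ const 1ℤ
  d₁ n = trans (cong (λ k → const k n) (simplify ζ)) (-‿homo 1ℤ n)
    where
    simplify : ∀ z → ℤ.- (z ℤ.* 0ℤ) ℤ.- 1ℤ ≡ ℤ.- 1ℤ
    simplify = solve-∀

  d-step : ∀ k → d (2 + k) ≗ ⊖ (const ζ ⊛ d k)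
  d-step k n = trans (cong (λ j → const j n) (rearrange ζ (class (suc k)) (class k)))
    (trans (-‿homo (ζ ℤ.* (class (suc k) ℤ.- class k)) n) (cong ℤ.-_ (*-homo ζ (class (suc k) ℤ.- class k) n)))
    where
    rearrange : ∀ z a b → ℤ.- (z ℤ.* a) ℤ.- ℤ.- (z ℤ.* b) ≡ ℤ.- (z ℤ.* (a ℤ.- b))
    rearrange = solve-∀

  distinctWeight : List ℕ → ℤ
  distinctWeight xs = ζ ℤ.^ length xs ℤ.* indicator (unique? xs)

  D : ℕ → Series
  D N = genFun N distinctWeight

  -- Once N + 1 has been removed, a second copy would violate distinctness, so the bound falls to N
  -- and the recurrence is explicit.
  D-suc : ∀ N → D (suc N) ≗ D N ⊕ X ^ suc N ⊛ (const ζ ⊛ D N)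
  D-suc N n = trans (genFun-suc N distinctWeight n) (cong (ℤ._+_ (D N n)) (⊛-congˡ (X ^ suc N) inner n))
    where
    v : List ℕ → ℤ
    v xs = ζ ℤ.^ length xs ℤ.* indicator (unique? (suc N ∷ xs))

    repeated : ∀ {xs} → All (_≤ suc N) xs → v (suc N ∷ xs) ≡ 0ℤ
    repeated {xs} _ = trans
      (cong (ℤ._*_ (ζ ℤ.^ suc (length xs))) (indicator-no (unique? (suc N ∷ suc N ∷ xs))
        λ { ((p ∷ _) ∷ _) → p refl }))
      (ℤ.*-zeroʳ (ζ ℤ.^ suc (length xs)))

    fresh : ∀ {xs} → All (_≤ N) xs → v xs ≡ distinctWeight xs
    fresh {xs} b = cong (ℤ._*_ (ζ ℤ.^ length xs)) (indicator-⇔ (unique? (suc N ∷ xs)) (unique? xs)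
      (λ { (_ ∷ u) → u }) (λ u → All.map (λ x≤N → ℕ.>⇒≢ (s≤s x≤N)) b ∷ u))

    inner : genFun (suc N) (distinctWeight ∘ (suc N ∷_)) ≗ const ζ ⊛ D N
    inner i = trans
      (genFun-cong (suc N) (λ {xs} _ → ℤ.*-assoc ζ (ζ ℤ.^ length xs) (indicator (unique? (suc N ∷ xs)))) i)
      (trans (genFun-* (suc N) ζ v i)
        (⊛-congˡ (const ζ) (λ j → trans (genFun-suc-vanish N v repeated j) (genFun-cong N fresh j)) i))

  P : ℕ → Series
  P N = dilate (D N)

  P-suc : ∀ N → P (suc N) ≗ P N ⊕ X ^ (suc N * 2) ⊛ (const ζ ⊛ P N)
  P-suc N n = trans (dilate-cong (D-suc N) n) (trans (dilate-⊕ (D N) (X ^ suc N ⊛ (const ζ ⊛ D N)) n)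
    (cong (ℤ._+_ (P N n)) (trans (dilate-X^-⊛ (suc N) (const ζ ⊛ D N) n)
      (⊛-congˡ (X ^ (suc N * 2)) (dilate-const-⊛ ζ (D N)) n))))

  z²≈1 : const ζ ⊛ const ζ ≗ const 1ℤ
  z²≈1 n = trans (sym (*-homo ζ ζ n)) (cong (λ k → const k n) ζ²≡1)

  open Shanks series const-homo using (module Products; module MexSeries)
  open MexSeries X (const ζ) z²≈1 d M F P (λ _ → refl) d₁ d-step
    (genFun₀ _) (genFun₀ _) (λ n → trans (dilate-cong (genFun₀ distinctWeight) n) (dilate-const 1ℤ n))
    F-suc (genFun-mex-suc class) P-suc
  open Products r using (x; B)

  U₀≡1 : ∀ n → U n 0 ≡ 1ℤ
  U₀≡1 n = ⊛-head₁ (B n) (V (n * 2)) (B₀≡1 n) (V₀≡1 (n * 2))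
    where
    r₀≡0 : r 0 ≡ 0ℤ
    r₀≡0 = cong ℤ.-_ (ℤ.*-zeroʳ ζ)
    B₀≡1 : ∀ n → B n 0 ≡ 1ℤ
    B₀≡1 zero    = refl
    B₀≡1 (suc n) = ⊛-head₁ (B n) (const 1ℤ ⊕ ⊖ x n) (B₀≡1 n)
      (1-head₁ (x n) (⊛-head₀ r ((r ⊛ r) ^ n) r₀≡0))
    V₀≡1 : ∀ k → V k 0 ≡ 1ℤ
    V₀≡1 zero    = refl
    V₀≡1 (suc k) = ⊛-head₁ (V k) (const 1ℤ ⊕ ⊖ (const ζ ⊛ X ^ suc k)) (V₀≡1 k)
      (1-head₁ (const ζ ⊛ X ^ suc k) (ℤ.*-zeroʳ ζ))

  -- `U n` has constant term 1, and U (M - P) vanishes through degree 2n, beyond the degree n that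
  -- is needed.
  M≡P : ∀ n → M (n * 2) n ≡ P n n
  M≡P n = ℤ.i-j≡0⇒i≡j (M (n * 2) n) (P n n) (⊛-cancel n (M (n * 2) ⊕ ⊖ P n) (U n) (U₀≡1 n) vanish)
    where
    vanish : ∀ i → i ≤ n → ((M (n * 2) ⊕ ⊖ P n) ⊛ U n) i ≡ 0ℤ
    vanish i i≤n = trans (⊛-comm (M (n * 2) ⊕ ⊖ P n) (U n) i) (trans (proj₂ (U*[M-P] n) i)
      (X^-⊛-below (suc (n * 2)) (proj₁ (U*[M-P] n)) (s≤s (ℕ.≤-trans i≤n (ℕ.m≤m*n n 2)))))

  -- From weighted coefficients back to counts

  ζ*ζ* : ∀ k → ζ ℤ.* (ζ ℤ.* k) ≡ k
  ζ*ζ* k = trans (sym (ℤ.*-assoc ζ ζ k)) (trans (cong (ℤ._* k) ζ²≡1) (ℤ.*-identityˡ k))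

  ζ^≡ : ∀ n → ζ ℤ.^ n ≡ indicator (even? n) ℤ.+ ζ ℤ.* indicator (odd? n)
  ζ^≡ n = trans (go n) (cong (λ k → indicator (even? n) ℤ.+ ζ ℤ.* k) (sym (indicator-¬ (even? n))))
    where
    go : ∀ n → ζ ℤ.^ n ≡ indicator (even? n) ℤ.+ ζ ℤ.* (1ℤ ℤ.- indicator (even? n))
    go zero          = sym (cong (ℤ._+_ 1ℤ) (ℤ.*-zeroʳ ζ))
    go (suc zero)    = sym (ℤ.+-identityˡ (ζ ℤ.* 1ℤ))
    go (suc (suc n)) = trans (ζ*ζ* (ζ ℤ.^ n)) (trans (go n)
      (cong (λ k → k ℤ.+ ζ ℤ.* (1ℤ ℤ.- k))
        (indicator-⇔ (even? n) (even? (2 + n)) (∣m∣n⇒∣m+n ∣-refl) (λ p → ∣m+n∣m⇒∣n p ∣-refl))))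

  class≡ : ∀ m → class m ≡ indicator (m % 4 ℕ.≟ 1) ℤ.- ζ ℤ.* indicator (m % 4 ℕ.≟ 3)
  class≡ 0 = sym (cong (λ k → 0ℤ ℤ.- k) (ℤ.*-zeroʳ ζ))
  class≡ 1 = sym (cong (λ k → 1ℤ ℤ.- k) (ℤ.*-zeroʳ ζ))
  class≡ 2 = trans (cong ℤ.-_ (ℤ.*-zeroʳ ζ)) (sym (cong (λ k → 0ℤ ℤ.- k) (ℤ.*-zeroʳ ζ)))
  class≡ 3 = sym (ℤ.+-identityˡ (ℤ.- (ζ ℤ.* 1ℤ)))
  -- The remainder modulo 4 reduces by computation; two rounds of the recursion of `class`
  -- contribute ζ² = 1.
  class≡ (suc (suc (suc (suc m)))) = trans (signs ζ (class m)) (trans (ζ*ζ* (class m)) (class≡ m))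
    where
    signs : ∀ z k → ℤ.- (z ℤ.* ℤ.- (z ℤ.* k)) ≡ z ℤ.* (z ℤ.* k)
    signs = solve-∀

  -- Odd length and mex 3 modulo 4 weigh ζ (-ζ) = -1, so these partitions are set against those of
  -- even length and mex 1; the remaining two kinds carry ζ and -ζ.
  M-count : ∀ n → M (n * 2) n ≡
    (ℤ.+ mᵉ 1 4 n ℤ.- ℤ.+ mᵒ 3 4 n) ℤ.+ ζ ℤ.* (ℤ.+ mᵒ 1 4 n ℤ.- ℤ.+ mᵉ 3 4 n)
  M-count n = begin
    ∑ (restricted (n * 2) n) (mexWeight class)
      ≡⟨ cong (λ L → ∑ L (mexWeight class)) (restricted-all (ℕ.m≤m*n n 2)) ⟩
    ∑ L (mexWeight class)
      ≡⟨ ∑-cong L (λ {xs} _ → pointwise xs) ⟩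
    ∑ L (λ xs → i 1e xs ℤ.+ (-1ℤ ℤ.* i 3o xs ℤ.+ (ζ ℤ.* i 1o xs ℤ.+ (ℤ.- ζ) ℤ.* i 3e xs)))
      ≡⟨ ∑-+ L (i 1e) _ ⟩
    ∑ L (i 1e) ℤ.+ ∑ L (λ xs → -1ℤ ℤ.* i 3o xs ℤ.+ (ζ ℤ.* i 1o xs ℤ.+ (ℤ.- ζ) ℤ.* i 3e xs))
      ≡⟨ cong (ℤ._+_ (∑ L (i 1e))) (trans (∑-+ L _ _) (cong₂ ℤ._+_ (∑-* L -1ℤ (i 3o))
           (trans (∑-+ L _ _) (cong₂ ℤ._+_ (∑-* L ζ (i 1o)) (∑-* L (ℤ.- ζ) (i 3e)))))) ⟩
    ∑ L (i 1e) ℤ.+ (-1ℤ ℤ.* ∑ L (i 3o) ℤ.+ (ζ ℤ.* ∑ L (i 1o) ℤ.+ (ℤ.- ζ) ℤ.* ∑ L (i 3e)))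
      ≡⟨ cong₂ ℤ._+_ (count 1e) (cong₂ (λ a b → -1ℤ ℤ.* a ℤ.+ b) (count 3o)
           (cong₂ (λ a b → ζ ℤ.* a ℤ.+ (ℤ.- ζ) ℤ.* b) (count 1o) (count 3e))) ⟩
    ℤ.+ mᵉ 1 4 n ℤ.+ (-1ℤ ℤ.* ℤ.+ mᵒ 3 4 n ℤ.+ (ζ ℤ.* ℤ.+ mᵒ 1 4 n ℤ.+ (ℤ.- ζ) ℤ.* ℤ.+ mᵉ 3 4 n))
      ≡⟨ collect ζ (ℤ.+ mᵉ 1 4 n) (ℤ.+ mᵒ 3 4 n) (ℤ.+ mᵒ 1 4 n) (ℤ.+ mᵉ 3 4 n) ⟩
    _ ∎
    where
    open ≡-Reasoning
    L = partitions n
    1e = λ xs → mexCong? 1 4 xs ×-dec even? (length xs)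
    1o = λ xs → mexCong? 1 4 xs ×-dec odd?  (length xs)
    3e = λ xs → mexCong? 3 4 xs ×-dec even? (length xs)
    3o = λ xs → mexCong? 3 4 xs ×-dec odd?  (length xs)
    i : ∀ {Q : Pred (List ℕ) 0ℓ} → Decidable Q → List ℕ → ℤ
    i Q? xs = indicator (Q? xs)
    count : ∀ {Q : Pred (List ℕ) 0ℓ} (Q? : Decidable Q) → ∑ L (i Q?) ≡ ℤ.+ countPartitions Q? n
    count Q? = sym (length-filter Q? L)
    collect : ∀ z a b c d →
      a ℤ.+ (-1ℤ ℤ.* b ℤ.+ (z ℤ.* c ℤ.+ (ℤ.- z) ℤ.* d)) ≡ (a ℤ.- b) ℤ.+ z ℤ.* (c ℤ.- d)
    collect = solve-∀
    expand : ∀ z e o a b → (e ℤ.+ z ℤ.* o) ℤ.* (a ℤ.- z ℤ.* b) ≡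
      a ℤ.* e ℤ.+ (-1ℤ ℤ.* (z ℤ.* (z ℤ.* (b ℤ.* o))) ℤ.+ (z ℤ.* (a ℤ.* o) ℤ.+ (ℤ.- z) ℤ.* (b ℤ.* e)))
    expand = solve-∀
    pointwise : ∀ xs → mexWeight class xs ≡
      i 1e xs ℤ.+ (-1ℤ ℤ.* i 3o xs ℤ.+ (ζ ℤ.* i 1o xs ℤ.+ (ℤ.- ζ) ℤ.* i 3e xs))
    pointwise xs
      rewrite indicator-× (mexCong? 1 4 xs) (even? (length xs)) | indicator-× (mexCong? 1 4 xs) (odd? (length xs))
            | indicator-× (mexCong? 3 4 xs) (even? (length xs)) | indicator-× (mexCong? 3 4 xs) (odd? (length xs)) =
      trans (cong₂ ℤ._*_ (ζ^≡ (length xs)) (class≡ (mex xs)))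
        (trans (expand ζ e o a b)
          (cong (λ k → a ℤ.* e ℤ.+ (-1ℤ ℤ.* k ℤ.+ (ζ ℤ.* (a ℤ.* o) ℤ.+ (ℤ.- ζ) ℤ.* (b ℤ.* e)))) (ζ*ζ* (b ℤ.* o))))
      where
      e = indicator (even? (length xs))
      o = indicator (odd? (length xs))
      a = indicator (mexCong? 1 4 xs)
      b = indicator (mexCong? 3 4 xs)

  D-count : ∀ {N m} → m ≤ N → D N m ≡ ℤ.+ qᵉ m ℤ.+ ζ ℤ.* ℤ.+ qᵒ m
  D-count {N} {m} m≤N = begin
    ∑ (restricted N m) distinctWeight
      ≡⟨ cong (λ L → ∑ L distinctWeight) (restricted-all m≤N) ⟩
    ∑ L distinctWeight
      ≡⟨ ∑-cong L (λ {xs} _ → pointwise xs) ⟩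
    ∑ L (λ xs → indicator (qe xs) ℤ.+ ζ ℤ.* indicator (qo xs))
      ≡⟨ trans (∑-+ L _ _) (cong (ℤ._+_ (∑ L (indicator ∘ qe))) (∑-* L ζ (indicator ∘ qo))) ⟩
    ∑ L (indicator ∘ qe) ℤ.+ ζ ℤ.* ∑ L (indicator ∘ qo)
      ≡⟨ cong₂ (λ a b → a ℤ.+ ζ ℤ.* b) (length-filter qe L) (length-filter qo L) ⟨
    ℤ.+ qᵉ m ℤ.+ ζ ℤ.* ℤ.+ qᵒ m ∎
    where
    open ≡-Reasoning
    L = partitions m
    qe = λ xs → unique? xs ×-dec even? (length xs)
    qo = λ xs → unique? xs ×-dec odd?  (length xs)
    expand : ∀ z e o u → (e ℤ.+ z ℤ.* o) ℤ.* u ≡ u ℤ.* e ℤ.+ z ℤ.* (u ℤ.* o)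
    expand = solve-∀
    pointwise : ∀ xs → distinctWeight xs ≡ indicator (qe xs) ℤ.+ ζ ℤ.* indicator (qo xs)
    pointwise xs rewrite indicator-× (unique? xs) (even? (length xs)) | indicator-× (unique? xs) (odd? (length xs)) =
      trans (cong (ℤ._* indicator (unique? xs)) (ζ^≡ (length xs)))
        (expand ζ (indicator (even? (length xs))) (indicator (odd? (length xs))) (indicator (unique? xs)))

-- Separation of the two length parities

parity : ∀ n → (∃ λ m → n ≡ m * 2) ⊎ (∃ λ m → n ≡ suc (m * 2))
parity zero = inj₁ (0 , refl)
parity (suc n) with parity n
... | inj₁ (m , refl) = inj₂ (m , refl)
... | inj₂ (m , refl) = inj₁ (suc m , refl)

-- Half the sum and half the difference of the cases ζ = 1 and ζ = -1 isolate the two coefficients;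
-- moving the subtracted terms across returns to the naturals.
separate-signs : ∀ a b c d e f → (∀ ζ → ζ ℤ.* ζ ≡ 1ℤ →
    (ℤ.+ a ℤ.- ℤ.+ b) ℤ.+ ζ ℤ.* (ℤ.+ c ℤ.- ℤ.+ d) ≡ ℤ.+ e ℤ.+ ζ ℤ.* ℤ.+ f) →
  c ≡ d + f × a ≡ b + e
separate-signs a b c d e f eq = lift c d f odd-part , lift a b e even-part
  where
  lift : ∀ x y w → ℤ.+ x ℤ.- ℤ.+ y ≡ ℤ.+ w → x ≡ y + w
  lift x y w p = ℤ.+-injective (trans (rearrange (ℤ.+ x) (ℤ.+ y)) (cong (ℤ._+_ (ℤ.+ y)) p))
    where
    rearrange : ∀ x y → x ≡ y ℤ.+ (x ℤ.- y)
    rearrange = solve-∀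
  u = ℤ.+ a ℤ.- ℤ.+ b
  v = ℤ.+ c ℤ.- ℤ.+ d
  plus : u ℤ.+ 1ℤ ℤ.* v ≡ ℤ.+ e ℤ.+ 1ℤ ℤ.* ℤ.+ f
  plus = eq 1ℤ refl
  minus : u ℤ.+ -1ℤ ℤ.* v ≡ ℤ.+ e ℤ.+ -1ℤ ℤ.* ℤ.+ f
  minus = eq -1ℤ refl
  even-part : u ≡ ℤ.+ e
  even-part = ℤ.*-cancelˡ-≡ (ℤ.+ 2) _ _
    (trans (twice u v) (trans (cong₂ ℤ._+_ plus minus) (sym (twice (ℤ.+ e) (ℤ.+ f)))))
    where
    twice : ∀ x y → ℤ.+ 2 ℤ.* x ≡ (x ℤ.+ 1ℤ ℤ.* y) ℤ.+ (x ℤ.+ -1ℤ ℤ.* y)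
    twice = solve-∀
  odd-part : v ≡ ℤ.+ f
  odd-part = ℤ.*-cancelˡ-≡ (ℤ.+ 2) _ _
    (trans (twice u v) (trans (cong₂ ℤ._-_ plus minus) (sym (twice (ℤ.+ e) (ℤ.+ f)))))
    where
    twice : ∀ x y → ℤ.+ 2 ℤ.* y ≡ (x ℤ.+ 1ℤ ℤ.* y) ℤ.- (x ℤ.+ -1ℤ ℤ.* y)
    twice = solve-∀

double-even : ∀ m → Even (m * 2)
double-even m = divides m refl

suc-double-odd : ∀ m → Odd (suc (m * 2))
suc-double-odd m even
  with ∣m+n∣m⇒∣n (subst (2 ∣_) (ℕ.+-comm 1 (m * 2)) even) (double-even m)
... | divides zero ()
... | divides (suc _) ()

counts-even : ∀ m → let n = m * 2 in
  mᵒ 1 4 n ≡ mᵉ 3 4 n + qᵒ m × mᵉ 1 4 n ≡ mᵒ 3 4 n + qᵉ m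
counts-even m = separate-signs (mᵉ 1 4 n) (mᵒ 3 4 n) (mᵒ 1 4 n) (mᵉ 3 4 n) (qᵉ m) (qᵒ m) λ ζ ζ²≡1 →
  let open Weighted ζ ζ²≡1 in
  trans (sym (M-count n)) (trans (M≡P n) (trans (dilate-even (D n) m) (D-count (ℕ.m≤m*n m 2))))
  where n = m * 2

-- A series in X² has no odd coefficients; the zeros occupy the places of the two counts of distinct
-- partitions.
counts-odd : ∀ m → let n = suc (m * 2) in
  mᵒ 1 4 n ≡ mᵉ 3 4 n + 0 × mᵉ 1 4 n ≡ mᵒ 3 4 n + 0
counts-odd m = separate-signs (mᵉ 1 4 n) (mᵒ 3 4 n) (mᵒ 1 4 n) (mᵉ 3 4 n) 0 0 λ ζ ζ²≡1 →
  let open Weighted ζ ζ²≡1 in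
  trans (sym (M-count n)) (trans (M≡P n) (trans (dilate-odd (D n) m)
    (sym (trans (ℤ.+-identityˡ (ζ ℤ.* 0ℤ)) (ℤ.*-zeroʳ ζ)))))
  where n = suc (m * 2)

theorem3p4 : ∀ (n : ℕ) → n ≥ 1 →
    ((Odd  n → mᵒ 1 4 n ≡ mᵉ 3 4 n) ×
    (Even n → mᵒ 1 4 n ≡ mᵉ 3 4 n + qᵒ (n / 2)))
    × ((Odd  n → mᵉ 1 4 n ≡ mᵒ 3 4 n) ×
    (Even n → mᵉ 1 4 n ≡ mᵒ 3 4 n + qᵉ (n / 2)))
theorem3p4 n _ = Sum.[ even-case , odd-case ]′ (parity n)
  where
  even-case : (∃ λ m → n ≡ m * 2) → _
  even-case (m , refl) =
    ((λ odd → contradiction (double-even m) odd) ,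
      λ _ → trans (proj₁ (counts-even m)) (cong (λ k → mᵉ 3 4 n + qᵒ k) half)) ,
    ((λ odd → contradiction (double-even m) odd) ,
      λ _ → trans (proj₂ (counts-even m)) (cong (λ k → mᵒ 3 4 n + qᵉ k) half))
    where
    half : m ≡ n / 2
    half = sym (m*n/n≡m m 2)
  odd-case : (∃ λ m → n ≡ suc (m * 2)) → _
  odd-case (m , refl) =
    ((λ _ → trans (proj₁ (counts-odd m)) (ℕ.+-identityʳ _)) , λ even → contradiction even (suc-double-odd m)) ,
    ((λ _ → trans (proj₂ (counts-odd m)) (ℕ.+-identityʳ _)) , λ even → contradiction even (suc-double-odd m))
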